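{- For every integer $n\ge 2$, $$A095240(n)=2\cdot\prod_{j=1}^{n-1}2^{\,d_{n,j}}\cdot(d_{n,j})!\cdot(b_{n,j}-d_{n,j})!\ .$$
   Context: Places $1,\dots,n$ stand in a row; neighbouring places have distance $1$. At any time at which at least one place is occupied, the distance of an empty place $x$ is $\min|x-y|$ over all occupied places $y$. Persons arrive one after another and each occupies one empty place. A run is a maximal block of consecutive empty places; its length is the number of its places. Basic politeness rule: every person except the first occupies one of the empty places whose distance is maximal among all empty places at that time. Modified politeness rule: every person except the first occupies one of the empty places of maximal distance, and among these always one lying in a run of greatest length. $A095240(n)$ (for $n\ge2$) is the number of sequences $(x_1,\dots,x_n)$ (permutations of $\{1,\dots,n\}$, $x_t$ being the place taken by the $t$-th person) in which $n$ persons fill all $n$ places obeying the modified politeness rule, the first person taking the leftmost or the rightmost place ($x_1\in\{1,n\}$). For positive integers $p,k$, consider $p$ places filled by $p$ persons according to the basic politeness rule with the first person taking the leftmost place. $b_{p,k}$ is the number of persons (the first person is not counted) who, at the moment of choosing, occupy a place of distance exactly $k$. $d_{p,k}$ (also for $k=1$) is the number of different sets of two neighbouring places for which, at some time during the filling, both places are empty and both have distance exactly $k$. These numbers do not depend on the choices made during the filling. -}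

module Defs where

open import Data.Fin.Base using (Fin; toℕ; _≤_)
open import Data.Fin.Properties using (all?; any?; _≟_; _≤?_; ¬∀⟶∃¬; pigeonhole; <⇒≢)
open import Data.List.Base as List using (List; []; _∷_; allFin; applyUpTo; cartesianProduct; cartesianProductWith; filter; length)
open import Data.List.Extrema.Nat using (argmax; argmax-all; f[xs]≤f[argmax])
open import Data.List.Membership.Propositional using (_∈_; _∉_)
open import Data.List.Membership.Propositional.Properties using (∈-allFin; ∈-filter⁺)
open import Data.List.NonEmpty as List⁺ using (List⁺; foldr₁; toList; _∷⁺_)
open import Data.List.Relation.Unary.All as All using ()
open import Data.List.Relation.Unary.All.Properties using (all-filter)
open import Data.List.Relation.Unary.Any as Any using (Any)
open import Data.List.Relation.Unary.Any.Properties using (lookup-index)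
open import Data.Nat.Base as ℕ using (ℕ; zero; suc; _⊓_; _∸_; ∣_-_∣)
open import Data.Nat.ListAction using (product)
import Data.Nat.Properties as ℕ
open import Data.Product.Base using (_×_; _,_; ∃; ∃₂)
open import Data.Sum.Base using (_⊎_)
open import Data.Unit.Base using (⊤; tt)
open import Data.Vec.Base as Vec using (Vec)
open import Relation.Binary.PropositionalEquality using (_≡_; refl; sym; trans; cong)
open import Relation.Nullary.Decidable using (Dec; yes; no; ¬?; _×-dec_; _⊎-dec_; _→-dec_)

import Data.List.Membership.DecPropositional as DecMembership

private
  variable
    m n : ℕ

-- The place number i of the row is the element of Fin n with toℕ equal to i ∸ 1.

-- The places occupied at a time when at least one is, the latest one first.
Occupied : ℕ → Set
Occupied n = List⁺ (Fin n)

Empty : Occupied n → Fin n → Set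
Empty occ x = x ∉ toList occ

distance : Occupied n → Fin n → ℕ
distance occ x = foldr₁ _⊓_ (List⁺.map (λ y → ∣ toℕ x - toℕ y ∣) occ)

-- The places from a to b inclusive; its length is  blockLength a b.
EmptyBlock : Occupied n → Fin n → Fin n → Set
EmptyBlock occ a b = a ≤ b × (∀ z → a ≤ z → z ≤ b → Empty occ z)

Run : Occupied n → Fin n → Fin n → Set
Run occ a b = EmptyBlock occ a b
            × (∀ a′ b′ → a′ ≤ a → b ≤ b′ → EmptyBlock occ a′ b′ → a′ ≡ a × b′ ≡ b)

blockLength : Fin n → Fin n → ℕ
blockLength a b = suc (toℕ b ∸ toℕ a)

RunOf : Occupied n → Fin n → Fin n → Fin n → Set
RunOf occ x a b = Run occ a b × a ≤ x × x ≤ b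

BasicRule : Occupied n → Fin n → Set
BasicRule occ x = Empty occ x × (∀ y → Empty occ y → distance occ y ℕ.≤ distance occ x)

ModifiedRule : Occupied n → Fin n → Set
ModifiedRule occ x =
  BasicRule occ x ×
  (∃₂ λ a b → RunOf occ x a b ×
    (∀ y → BasicRule occ y → ∀ a′ b′ → RunOf occ y a′ b′ → blockLength a′ b′ ℕ.≤ blockLength a b))

-- The persons still to come, in order of arrival, all choose according to the
-- rule R. Since both rules demand an empty place, a sequence of n places in a
-- row of n places which obeys one of them is automatically a permutation.
Obeys : (Occupied n → Fin n → Set) → Occupied n → Vec (Fin n) m → Set
Obeys R occ Vec.[]       = ⊤
Obeys R occ (x Vec.∷ xs) = R occ x × Obeys R (x ∷⁺ occ) xs

-- F restricts the place of the first person, R rules all later choices.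
Filling : (Fin n → Set) → (Occupied n → Fin n → Set) → Vec (Fin n) m → Set
Filling F R Vec.[]       = ⊤
Filling F R (x Vec.∷ xs) = F x × Obeys R List⁺.[ x ] xs

Leftmost Rightmost : Fin n → Set
Leftmost      x = toℕ x ≡ 0
Rightmost {n} x = suc (toℕ x) ≡ n

ModifiedFilling : Vec (Fin n) n → Set
ModifiedFilling = Filling (λ x → Leftmost x ⊎ Rightmost x) ModifiedRule

BasicFilling : Vec (Fin n) n → Set
BasicFilling = Filling Leftmost BasicRule

empty? : (occ : Occupied n) (x : Fin n) → Dec (Empty occ x)
empty? occ x = ¬? (x ∈? toList occ)
  where open DecMembership _≟_ using (_∈?_)

emptyBlock? : (occ : Occupied n) (a b : Fin n) → Dec (EmptyBlock occ a b)
emptyBlock? occ a b =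
  (a ≤? b) ×-dec all? (λ z → (a ≤? z) →-dec ((z ≤? b) →-dec empty? occ z))

run? : (occ : Occupied n) (a b : Fin n) → Dec (Run occ a b)
run? occ a b = emptyBlock? occ a b ×-dec
  all? (λ a′ → all? (λ b′ → (a′ ≤? a) →-dec ((b ≤? b′) →-dec
    (emptyBlock? occ a′ b′ →-dec ((a′ ≟ a) ×-dec (b′ ≟ b))))))

runOf? : (occ : Occupied n) (x a b : Fin n) → Dec (RunOf occ x a b)
runOf? occ x a b = run? occ a b ×-dec ((a ≤? x) ×-dec (x ≤? b))

basicRule? : (occ : Occupied n) (x : Fin n) → Dec (BasicRule occ x)
basicRule? occ x = empty? occ x ×-dec
  all? (λ y → empty? occ y →-dec (distance occ y ℕ.≤? distance occ x))

modifiedRule? : (occ : Occupied n) (x : Fin n) → Dec (ModifiedRule occ x)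
modifiedRule? occ x = basicRule? occ x ×-dec
  any? (λ a → any? (λ b → runOf? occ x a b ×-dec
    all? (λ y → basicRule? occ y →-dec all? (λ a′ → all? (λ b′ →
      runOf? occ y a′ b′ →-dec (blockLength a′ b′ ℕ.≤? blockLength a b))))))

obeys? : {R : Occupied n → Fin n → Set} → (∀ occ x → Dec (R occ x)) →
         (occ : Occupied n) (xs : Vec (Fin n) m) → Dec (Obeys R occ xs)
obeys? R? occ Vec.[]       = yes tt
obeys? R? occ (x Vec.∷ xs) = R? occ x ×-dec obeys? R? (x ∷⁺ occ) xs

filling? : {F : Fin n → Set} {R : Occupied n → Fin n → Set} →
           (∀ x → Dec (F x)) → (∀ occ x → Dec (R occ x)) →
           (xs : Vec (Fin n) m) → Dec (Filling F R xs)
filling? F? R? Vec.[]       = yes tt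
filling? F? R? (x Vec.∷ xs) = F? x ×-dec obeys? R? List⁺.[ x ] xs

modifiedFilling? : (σ : Vec (Fin n) n) → Dec (ModifiedFilling σ)
modifiedFilling? {n} =
  filling? (λ x → (toℕ x ℕ.≟ 0) ⊎-dec (suc (toℕ x) ℕ.≟ n)) modifiedRule?

-- Every sequence of m places in a row of n places, listed exactly once.
sequences : ∀ n m → List (Vec (Fin n) m)
sequences n zero    = Vec.[] ∷ []
sequences n (suc m) = cartesianProductWith Vec._∷_ (allFin n) (sequences n m)

A095240 : ℕ → ℕ
A095240 n = length (filter modifiedFilling? (sequences n n))

-- The distances, at the moment of choosing, of the places taken by the persons
-- who are still to come.
chosenDistances : Occupied n → Vec (Fin n) m → List ℕ
chosenDistances occ Vec.[]       = []
chosenDistances occ (x Vec.∷ xs) = distance occ x ∷ chosenDistances (x ∷⁺ occ) xs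

states : Occupied n → Vec (Fin n) m → List (Occupied n)
states occ Vec.[]       = occ ∷ []
states occ (x Vec.∷ xs) = occ ∷ states (x ∷⁺ occ) xs

-- b σ k and d σ k are the numbers b_{p,k} and d_{p,k} as read off from the
-- filling σ of p places. In a basic filling d σ k is at most b σ k, as one place
-- of every pair is taken while it has distance k; so b σ k ∸ d σ k is their
-- true difference.
b : Vec (Fin n) m → ℕ → ℕ
b Vec.[]       k = 0
b (x Vec.∷ xs) k = length (filter (ℕ._≟ k) (chosenDistances List⁺.[ x ] xs))

EmptyAt : ℕ → Fin n → Occupied n → Set
EmptyAt k x occ = Empty occ x × distance occ x ≡ k

emptyAt? : ∀ k (x : Fin n) occ → Dec (EmptyAt k x occ)
emptyAt? k x occ = empty? occ x ×-dec (distance occ x ℕ.≟ k)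

-- A set of two neighbouring places is given as the ordered pair of its left and
-- its right place, so each set is counted once.
NeighboursAt : List (Occupied n) → ℕ → Fin n × Fin n → Set
NeighboursAt occs k (x , y) =
  suc (toℕ x) ≡ toℕ y × Any (λ occ → EmptyAt k x occ × EmptyAt k y occ) occs

neighboursAt? : ∀ (occs : List (Occupied n)) k xy → Dec (NeighboursAt occs k xy)
neighboursAt? occs k (x , y) = (suc (toℕ x) ℕ.≟ toℕ y) ×-dec
  Any.any? (λ occ → emptyAt? k x occ ×-dec emptyAt? k y occ) occs

d : Vec (Fin n) m → ℕ → ℕ
d     Vec.[]       k = 0
d {n} (x Vec.∷ xs) k =
  length (filter (neighboursAt? (states List⁺.[ x ] xs) k)
                 (cartesianProduct (allFin n) (allFin n)))

-- The product of f 1 , … , f (n ∸ 1).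
∏[1≤j<_] : ℕ → (ℕ → ℕ) → ℕ
∏[1≤j< n ] f = product (applyUpTo (λ i → f (suc i)) (n ∸ 1))

-- Every row has a basic filling, so that quantifying over all of them is never
-- vacuous.

exists-empty : (occ : Occupied n) → List⁺.length occ ℕ.< n → ∃ (Empty occ)
exists-empty {n} occ len<n = ¬∀⟶∃¬ n (_∈ toList occ) (_∈? toList occ) λ full →
  let i , j , i<j , eq = pigeonhole len<n (λ x → Any.index (full x))
  in  <⇒≢ i<j (trans (lookup-index (full i))
                (trans (cong (List.lookup (toList occ)) eq)
                       (sym (lookup-index (full j)))))
  where open DecMembership _≟_ using (_∈?_)

exists-choice : (occ : Occupied n) → List⁺.length occ ℕ.< n → ∃ (BasicRule occ)
exists-choice {n} occ len<n with exists-empty occ len<n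
... | e , e-empty =
  argmax (distance occ) e empties ,
  argmax-all (distance occ) e-empty (all-filter (empty? occ) (allFin n)) ,
  λ y y-empty → All.lookup (f[xs]≤f[argmax] {f = distance occ} e empties)
                           (∈-filter⁺ (empty? occ) (∈-allFin y) y-empty)
  where empties = filter (empty? occ) (allFin n)

exists-continuation : ∀ m (occ : Occupied n) → List⁺.length occ ℕ.+ m ≡ n →
                      ∃ λ (xs : Vec (Fin n) m) → Obeys BasicRule occ xs
exists-continuation zero    occ eq   = Vec.[] , tt
exists-continuation (suc m) occ eq   =
  let x , x-ok   = exists-choice occ (ℕ.<-≤-trans (ℕ.m<m+n (List⁺.length occ) ℕ.z<s) (ℕ.≤-reflexive eq))
      xs , xs-ok = exists-continuation m (x ∷⁺ occ) (trans (sym (ℕ.+-suc (List⁺.length occ) m)) eq)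
  in  x Vec.∷ xs , x-ok , xs-ok

exists-basicFilling : ∀ n → ∃ λ (σ : Vec (Fin n) n) → BasicFilling σ
exists-basicFilling zero    = Vec.[] , tt
exists-basicFilling (suc n) =
  let xs , xs-ok = exists-continuation n List⁺.[ Fin.zero ] refl
  in  Fin.zero Vec.∷ xs , refl , xs-ok

module Submission where

-- Once both ends are occupied the empty places form gaps between occupied ones.
-- A person obeying the basic rule takes a middle place of a gap, and one obeys
-- the modified rule exactly by taking a middle place of a longest gap. Let N(l)
-- be the number of gaps of length l that occur in the course of the filling; it
-- only depends on the lengths of the present gaps. Every person uses up one gap
-- and leaves two halves, so d_k = N(2k) and b_k - d_k = N(2k - 1), except that
-- the second person adds 1 to b_{n-1}. If the longest gaps have length l, there
-- are N(l) of them, each with 1 or 2 middle places, and the choice lowers N(l)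
-- by one; so the number of choices is the factor by which the product drops.

open import Defs
open import Data.Bool.Base using (if_then_else_; true; false)
open import Data.Fin.Base as Fin using (Fin; toℕ; fromℕ; fromℕ<; inject₁)
open import Data.Fin.Properties as Fin using (toℕ<n; toℕ-fromℕ; toℕ-fromℕ<; toℕ-inject₁; toℕ-injective)
open import Data.List.Base using (List; []; _∷_; _++_; length; filter; map; applyUpTo; allFin; cartesianProduct; cartesianProductWith)
open import Data.List.Extrema.Nat using (argmax; argmax-sel; f[⊥]≤f[argmax]; f[xs]≤f[argmax])
open import Data.List.Membership.Propositional using (_∈_; _∉_; find; lose)
open import Data.List.Membership.Propositional.Properties using (∈-∃++; ∈-allFin; ∈-cartesianProduct⁺)
open import Data.List.NonEmpty as List⁺ using (toList; _∷⁺_)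
open import Data.List.Properties using (filter-≐; filter-none; filter-++; length-++)
open import Data.List.Relation.Binary.Permutation.Propositional using (_↭_; ↭⇒↭ₛ)
open import Data.List.Relation.Binary.Permutation.Propositional.Properties using (shift; All-resp-↭; Any-resp-↭; ∈-resp-↭; map⁺)
import Data.List.Relation.Binary.Permutation.Setoid.Properties as Permutation
open import Data.List.Relation.Unary.All as All using (All; []; _∷_)
open import Data.List.Relation.Unary.AllPairs using (AllPairs; []; _∷_)
open import Data.List.Relation.Unary.Any as Any using (Any; here; there)
open import Data.List.Relation.Unary.Unique.Propositional using (Unique)
open import Data.List.Relation.Unary.Unique.Propositional.Properties using (allFin⁺; cartesianProduct⁺)
open import Data.Nat.Base using (ℕ; zero; suc; _+_; _*_; _^_; _∸_; _!; _⊓_; _⊔_; _≤_; _<_; z≤n; s≤s; ∣_-_∣; ⌊_/2⌋; ⌈_/2⌉)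
open import Data.Nat.ListAction using (sum; product)
open import Data.Nat.ListAction.Properties using (sum-↭)
open import Data.Nat.Properties
open import Data.Nat.Solver using (module +-*-Solver)
open import Data.Product.Base using (_×_; _,_; proj₁; proj₂; ∃; ∃₂)
open import Data.Sum.Base using (_⊎_; inj₁; inj₂; [_,_]′)
open import Data.Vec.Base as Vec using (Vec)
open import Function.Base using (_∘_)
open import Relation.Binary.Definitions using (tri<; tri≈; tri>)
open import Relation.Binary.PropositionalEquality using (_≡_; _≢_; refl; sym; trans; cong; cong₂; subst; setoid; module ≡-Reasoning)
open import Relation.Nullary.Decidable using (Dec; yes; no; does; _×-dec_; _⊎-dec_)
open import Relation.Nullary.Negation using (¬_; contradiction)
open import Relation.Unary using (Decidable)

private
  variable
    A : Set
    n i j z : ℕ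

-- Counting

-- The lengths 2k - 1 and 2k tie: their middle places all have distance k. So the basic rule may
-- pass over a longest gap of length 2k in favour of one of length 2k - 1, and only the clause on
-- runs forbids this. Choices can therefore be counted along longest gaps, but b and d have to be
-- read off from a basic filling that treats the gaps in any order compatible with the distances.
-- One invariant serves both. N counts the gaps now present together with those still to arise, and
-- it is defined by repeated halving; splitting any gap of length l in its middle thus lowers N(l)
-- by one and leaves all other values alone. As halves are strictly shorter than the whole, nothing
-- of the greatest length can still arise, and there N counts just the present gaps.

𝟙 : {X : Set} → Dec X → ℕ
𝟙 X? = if does X? then 1 else 0

𝟙-yes : {X : Set} (X? : Dec X) → X → 𝟙 X? ≡ 1
𝟙-yes (yes _) _ = refl
𝟙-yes (no ¬x) x = contradiction x ¬x

𝟙-no : {X : Set} (X? : Dec X) → ¬ X → 𝟙 X? ≡ 0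
𝟙-no (yes x) ¬x = contradiction x ¬x
𝟙-no (no _)  _  = refl

𝟙-⇔ : {X Y : Set} (X? : Dec X) (Y? : Dec Y) → (X → Y) → (Y → X) → 𝟙 X? ≡ 𝟙 Y?
𝟙-⇔ (yes x) Y? f g = sym (𝟙-yes Y? (f x))
𝟙-⇔ (no ¬x) Y? f g = sym (𝟙-no Y? (¬x ∘ g))

𝟙-⊎ : {X Y Z : Set} (X? : Dec X) (Y? : Dec Y) (Z? : Dec Z) →
      (X → Y ⊎ Z) → (Y → X) → (Z → X) → (Y → ¬ Z) → 𝟙 X? ≡ 𝟙 Y? + 𝟙 Z?
𝟙-⊎ X? (yes y) Z? f g h disj = trans (𝟙-yes X? (g y)) (cong suc (sym (𝟙-no Z? (disj y))))
𝟙-⊎ X? (no ¬y) Z? f g h disj = 𝟙-⇔ X? Z? (λ x → resolve (f x)) h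
  where resolve : _ ⊎ _ → _
        resolve (inj₁ y) = contradiction y ¬y
        resolve (inj₂ z) = z

count : {P : A → Set} → Decidable P → List A → ℕ
count P? xs = length (filter P? xs)

count-∷ : {P : A → Set} (P? : Decidable P) (x : A) (xs : List A) → count P? (x ∷ xs) ≡ 𝟙 (P? x) + count P? xs
count-∷ P? x xs with does (P? x)
... | true  = refl
... | false = refl

count-cong : {P Q : A → Set} (P? : Decidable P) (Q? : Decidable Q) → (∀ {x} → P x → Q x) → (∀ {x} → Q x → P x) →
             (xs : List A) → count P? xs ≡ count Q? xs
count-cong P? Q? f g xs = cong length (filter-≐ P? Q? (f , g) xs)

count-⊎ : {P Q R : A → Set} (P? : Decidable P) (Q? : Decidable Q) (R? : Decidable R) →
          (∀ {x} → P x → Q x ⊎ R x) → (∀ {x} → Q x → P x) → (∀ {x} → R x → P x) →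
          (∀ {x} → Q x → ¬ R x) →
          (xs : List A) → count P? xs ≡ count Q? xs + count R? xs
count-⊎ P? Q? R? f g h disj []       = refl
count-⊎ P? Q? R? f g h disj (x ∷ xs) = begin
  count P? (x ∷ xs)                                           ≡⟨ count-∷ P? x xs ⟩
  𝟙 (P? x) + count P? xs                                      ≡⟨ cong₂ _+_ (𝟙-⊎ (P? x) (Q? x) (R? x) f g h disj) (count-⊎ P? Q? R? f g h disj xs) ⟩
  (𝟙 (Q? x) + 𝟙 (R? x)) + (count Q? xs + count R? xs)         ≡⟨ solve 4 (λ a b c d → (a :+ b) :+ (c :+ d) := (a :+ c) :+ (b :+ d)) refl (𝟙 (Q? x)) (𝟙 (R? x)) (count Q? xs) (count R? xs) ⟩
  (𝟙 (Q? x) + count Q? xs) + (𝟙 (R? x) + count R? xs)         ≡⟨ cong₂ _+_ (count-∷ Q? x xs) (count-∷ R? x xs) ⟨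
  count Q? (x ∷ xs) + count R? (x ∷ xs)                       ∎
  where open ≡-Reasoning
        open +-*-Solver

count-none : {P : A → Set} (P? : Decidable P) → (∀ {x} → ¬ P x) → (xs : List A) → count P? xs ≡ 0
count-none P? ¬p xs = cong length (filter-none P? (All.universal (λ _ → ¬p) xs))

count-single : {P : A → Set} (P? : Decidable P) {a : A} → (∀ {x} → P x → x ≡ a) → P a →
               {xs : List A} → Unique xs → a ∈ xs → count P? xs ≡ 1
count-single P? only pa {x ∷ xs} (x∉xs ∷ _) (here refl) = begin
  count P? (x ∷ xs)      ≡⟨ count-∷ P? x xs ⟩
  𝟙 (P? x) + count P? xs ≡⟨ cong₂ _+_ (𝟙-yes (P? x) pa)
                              (cong length (filter-none P? (All.map (λ x≢y py → x≢y (sym (only py))) x∉xs))) ⟩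
  1                      ∎
  where open ≡-Reasoning
count-single P? only pa {x ∷ xs} (x∉xs ∷ uniq) (there a∈xs) = begin
  count P? (x ∷ xs)      ≡⟨ count-∷ P? x xs ⟩
  𝟙 (P? x) + count P? xs ≡⟨ cong₂ _+_ (𝟙-no (P? x) (λ px → All.lookup x∉xs a∈xs (only px)))
                              (count-single P? only pa uniq a∈xs) ⟩
  1                      ∎
  where open ≡-Reasoning

-- Halving

data Half : ℕ → Set where
  even : ∀ k → Half (k + k)
  odd  : ∀ k → Half (suc (k + k))

half : ∀ m → Half m
half zero    = even 0
half (suc m) with half m
... | even k = odd k
... | odd k  = subst Half (cong suc (+-suc k k)) (even (suc k))

-- Here `m` is one less than the length of the gap, so an even `m` means a gap of odd length, with a
-- single middle place.
middles : ∀ {m} → Half m → ℕ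
middles (even _) = 1
middles (odd _)  = 2

double-injective : ∀ {k i} → k + k ≡ i + i → k ≡ i
double-injective {k} {i} eq = trans (n≡⌊n+n/2⌋ k) (trans (cong ⌊_/2⌋ eq) (sym (n≡⌊n+n/2⌋ i)))

double≢1+double : ∀ k i → k + k ≢ suc (i + i)
double≢1+double k i eq = 1+n≢n (trans (sym eq) (cong (λ l → l + l) k≡i))
  where k≡i : k ≡ i
        k≡i = trans (n≡⌊n+n/2⌋ k) (trans (cong ⌊_/2⌋ eq) (sym (n≡⌈n+n/2⌉ i)))

-- The parts to the left and right of a middle place: `equal` arises in gaps of odd length, while
-- `right` and `left` belong to the two middle places of a gap of even length.
data Balanced : ℕ → ℕ → Set where
  equal : ∀ i → Balanced i i
  right : ∀ i → Balanced i (suc i)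
  left  : ∀ i → Balanced (suc i) i

balanced-sym : ∀ {i j} → Balanced i j → Balanced j i
balanced-sym (equal i) = equal i
balanced-sym (right i) = left i
balanced-sym (left i)  = right i

balanced-halves : ∀ {i j} → Balanced i j →
                  (⌊ i + j /2⌋ ≡ i × ⌈ i + j /2⌉ ≡ j) ⊎ (⌊ i + j /2⌋ ≡ j × ⌈ i + j /2⌉ ≡ i)
balanced-halves (equal i) = inj₁ (sym (n≡⌊n+n/2⌋ i) , sym (n≡⌈n+n/2⌉ i))
balanced-halves (right i) rewrite +-suc i i = inj₁ (sym (n≡⌈n+n/2⌉ i) , cong suc (sym (n≡⌊n+n/2⌋ i)))
balanced-halves (left i)  = inj₂ (sym (n≡⌈n+n/2⌉ i) , cong suc (sym (n≡⌊n+n/2⌋ i)))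

-- The bound f on the depth of the recursion is immaterial once it reaches the length.
pieces : (f len r : ℕ) → ℕ
pieces zero    _       _ = 0
pieces (suc f) zero    _ = 0
pieces (suc f) (suc m) r = 𝟙 (m ≟ r) + (pieces f ⌊ m /2⌋ r + pieces f ⌈ m /2⌉ r)

pieces-enough : ∀ {f f′ len} r → len ≤ f → len ≤ f′ → pieces f len r ≡ pieces f′ len r
pieces-enough {zero}  {zero}   {zero}  r _ _ = refl
pieces-enough {zero}  {suc f′} {zero}  r _ _ = refl
pieces-enough {suc f} {zero}   {zero}  r _ _ = refl
pieces-enough {suc f} {suc f′} {zero}  r _ _ = refl
pieces-enough {suc f} {suc f′} {suc m} r (s≤s m≤f) (s≤s m≤f′) = cong (𝟙 (m ≟ r) +_) (cong₂ _+_
  (pieces-enough r (≤-trans (⌊n/2⌋≤n m) m≤f) (≤-trans (⌊n/2⌋≤n m) m≤f′))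
  (pieces-enough r (≤-trans (⌈n/2⌉≤n m) m≤f) (≤-trans (⌈n/2⌉≤n m) m≤f′)))

-- The number of gaps of length suc r which occur while a gap of length len
-- between two occupied places is filled, each person taking a middle place.
gapCount : (len r : ℕ) → ℕ
gapCount len = pieces len len

gapCount-halves : ∀ m r → gapCount (suc m) r ≡ 𝟙 (m ≟ r) + (gapCount ⌊ m /2⌋ r + gapCount ⌈ m /2⌉ r)
gapCount-halves m r = cong (𝟙 (m ≟ r) +_)
  (cong₂ _+_ (pieces-enough r (⌊n/2⌋≤n m) ≤-refl) (pieces-enough r (⌈n/2⌉≤n m) ≤-refl))

-- The recursion is symmetric in the two halves, so either of the two middle places of a gap of even
-- length leaves the same count.
gapCount-split : ∀ {i j} → Balanced i j → ∀ r →
                 gapCount (suc (i + j)) r ≡ 𝟙 (i + j ≟ r) + (gapCount i r + gapCount j r)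
gapCount-split {i} {j} bal r with balanced-halves bal | gapCount-halves (i + j) r
... | inj₁ (p , q) | eq rewrite p | q = eq
... | inj₂ (p , q) | eq rewrite p | q = trans eq (cong (𝟙 (i + j ≟ r) +_) (+-comm (gapCount j r) (gapCount i r)))

pieces-large : ∀ f {len r} → len ≤ r → pieces f len r ≡ 0
pieces-large zero            _   = refl
pieces-large (suc f) {zero}  _   = refl
pieces-large (suc f) {suc m} m<r = cong₂ _+_ (𝟙-no (m ≟ _) (<⇒≢ m<r)) (cong₂ _+_
  (pieces-large f (≤-trans (⌊n/2⌋≤n m) (<⇒≤ m<r)))
  (pieces-large f (≤-trans (⌈n/2⌉≤n m) (<⇒≤ m<r))))

-- Halves are shorter than the whole, so at an index that no length exceeds only the gap itself can
-- count. This turns the recursive count into the number of longest gaps now present.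
gapCount-maximal : ∀ {len r} → len ≤ suc r → gapCount len r ≡ 𝟙 (len ≟ suc r)
gapCount-maximal {zero}      _         = refl
gapCount-maximal {suc m} {r} (s≤s m≤r) = begin
  gapCount (suc m) r                                 ≡⟨ cong (𝟙 (m ≟ r) +_) (cong₂ _+_
                                                          (pieces-large m (≤-trans (⌊n/2⌋≤n m) m≤r))
                                                          (pieces-large m (≤-trans (⌈n/2⌉≤n m) m≤r))) ⟩
  𝟙 (m ≟ r) + 0                                      ≡⟨ +-identityʳ _ ⟩
  𝟙 (m ≟ r)                                          ≡⟨ 𝟙-⇔ (m ≟ r) (suc m ≟ suc r) (cong suc) suc-injective ⟩
  𝟙 (suc m ≟ suc r)                                  ∎
  where open ≡-Reasoning

-- The product formula

product-applyUpTo-cong : ∀ {f g : ℕ → ℕ} n → (∀ i → i < n → f i ≡ g i) →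
                         product (applyUpTo f n) ≡ product (applyUpTo g n)
product-applyUpTo-cong zero    eq = refl
product-applyUpTo-cong (suc n) eq =
  cong₂ _*_ (eq 0 (s≤s z≤n)) (product-applyUpTo-cong n (λ i i<n → eq (suc i) (s≤s i<n)))

product-applyUpTo-scale : ∀ {f g : ℕ → ℕ} {k n} c → k < n → f k ≡ c * g k →
                          (∀ i → i ≢ k → f i ≡ g i) →
                          product (applyUpTo f n) ≡ c * product (applyUpTo g n)
product-applyUpTo-scale {f} {g} {zero} {suc n} c _ scaled same = begin
  f 0 * product (applyUpTo (f ∘ suc) n)       ≡⟨ cong₂ _*_ scaled (product-applyUpTo-cong n (λ i _ → same (suc i) λ ())) ⟩
  c * g 0 * product (applyUpTo (g ∘ suc) n)   ≡⟨ *-assoc c (g 0) _ ⟩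
  c * (g 0 * product (applyUpTo (g ∘ suc) n)) ∎
  where open ≡-Reasoning
product-applyUpTo-scale {f} {g} {suc k} {suc n} c (s≤s k<n) scaled same = begin
  f 0 * product (applyUpTo (f ∘ suc) n)         ≡⟨ cong₂ _*_ (same 0 λ ())
                                                     (product-applyUpTo-scale c k<n scaled (λ i i≢k → same (suc i) (i≢k ∘ suc-injective))) ⟩
  g 0 * (c * product (applyUpTo (g ∘ suc) n))   ≡⟨ solve 3 (λ x y z → x :* (y :* z) := y :* (x :* z)) refl (g 0) c _ ⟩
  c * (g 0 * product (applyUpTo (g ∘ suc) n))   ∎
  where open ≡-Reasoning
        open +-*-Solver

factor : (q q′ : ℕ) → ℕ
factor q q′ = 2 ^ q * q ! * q′ !

-- `N` is indexed by length minus one. The factor at `i` belongs to the distance k = i + 1; the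
-- arguments `suc (i + i)` and `i + i` stand for the lengths 2k and 2k - 1, the two whose middle
-- places have this distance.
weight : ℕ → (ℕ → ℕ) → ℕ
weight n N = product (applyUpTo (λ i → factor (N (suc (i + i))) (N (i + i))) n)

weight-cong : ∀ n {N N′ : ℕ → ℕ} → (∀ r → N r ≡ N′ r) → weight n N ≡ weight n N′
weight-cong n eq = product-applyUpTo-cong n (λ i _ → cong₂ factor (eq _) (eq _))

weight-zero : ∀ n {N : ℕ → ℕ} → (∀ r → N r ≡ 0) → weight n N ≡ 1
weight-zero n eq = trans (weight-cong n eq) (ones n)
  where ones : ∀ n → product (applyUpTo (λ _ → 1) n) ≡ 1
        ones zero    = refl
        ones (suc n) = trans (*-identityˡ _) (ones n)

module _ (n : ℕ) {m : ℕ} {N N′ : ℕ → ℕ} (eq : ∀ r → N r ≡ 𝟙 (m ≟ r) + N′ r) where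
  open ≡-Reasoning
  open +-*-Solver

  private
    at : N m ≡ suc (N′ m)
    at = trans (eq m) (cong (_+ N′ m) (𝟙-yes (m ≟ m) refl))

    off : ∀ {r} → m ≢ r → N r ≡ N′ r
    off {r} m≢r = trans (eq r) (cong (_+ N′ r) (𝟙-no (m ≟ r) m≢r))

  -- The value `N m` enters only the factor at ⌊m/2⌋. When it falls by one, its factorial loses the
  -- factor `N m`, and if the gap length is even the power of 2 loses a further 2; together these
  -- are `N m * middles h`. The bound keeps that factor inside the product.
  weight-step : (h : Half m) → ⌊ m /2⌋ < n → weight n N ≡ N m * middles h * weight n N′
  weight-step (even k) k<n = product-applyUpTo-scale (N m * 1) (subst (_< n) (sym (n≡⌊n+n/2⌋ k)) k<n)
    (begin
      factor (N (suc m)) (N m)                  ≡⟨ cong₂ factor (off (1+n≢n ∘ sym)) at ⟩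
      factor (N′ (suc m)) (suc (N′ m))          ≡⟨ solve 3 (λ x y z → x :* ((con 1 :+ y) :* z) := (con 1 :+ y) :* con 1 :* (x :* z)) refl
                                                     (2 ^ N′ (suc m) * N′ (suc m) !) (N′ m) (N′ m !) ⟩
      suc (N′ m) * 1 * factor (N′ (suc m)) (N′ m) ≡⟨ cong (λ q → q * 1 * factor (N′ (suc m)) (N′ m)) at ⟨
      N m * 1 * factor (N′ (suc m)) (N′ m)      ∎)
    (λ i i≢k → cong₂ factor (off (double≢1+double k i)) (off (i≢k ∘ sym ∘ double-injective)))
  weight-step (odd k) k<n = product-applyUpTo-scale (N m * 2) (subst (_< n) (sym (n≡⌈n+n/2⌉ k)) k<n)
    (begin
      factor (N m) (N (k + k))                  ≡⟨ cong₂ factor at (off 1+n≢n) ⟩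
      factor (suc (N′ m)) (N′ (k + k))          ≡⟨ solve 4 (λ x y z w → con 2 :* x :* ((con 1 :+ y) :* z) :* w := (con 1 :+ y) :* con 2 :* (x :* z :* w)) refl
                                                     (2 ^ N′ m) (N′ m) (N′ m !) (N′ (k + k) !) ⟩
      suc (N′ m) * 2 * factor (N′ m) (N′ (k + k)) ≡⟨ cong (λ q → q * 2 * factor (N′ m) (N′ (k + k))) at ⟨
      N m * 2 * factor (N′ m) (N′ (k + k))      ∎)
    (λ i i≢k → cong₂ factor (off (i≢k ∘ sym ∘ double-injective ∘ suc-injective)) (off (double≢1+double i k ∘ sym)))

-- Gaps

-- The occupied places lo and hi with only empty places in between; here places
-- are numbered from 0, as by toℕ.
record Gap : Set where
  constructor gap
  field
    lo len : ℕ
  hi : ℕ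
  hi = suc (lo + len)
open Gap

private
  variable
    g h : Gap
    gs : List Gap

Inside : ℕ → Gap → Set
Inside z g = lo g < z × z < hi g

-- z has i empty places of g to its left and j to its right.
Splits : ℕ → Gap → ℕ → ℕ → Set
Splits z g i j = z ≡ lo g + suc i × len g ≡ suc (i + j)

Disjoint : Gap → Gap → Set
Disjoint g h = ∀ {z} → Inside z g → ¬ Inside z h

inside⇒splits : ∀ g → Inside z g → ∃₂ (Splits z g)
inside⇒splits g (lo<z , z<hi) with m≤n⇒∃[o]m+o≡n lo<z | m≤n⇒∃[o]m+o≡n (≤-pred z<hi)
... | i , refl | j , eq = i , j , sym (+-suc (lo g) i) ,
  +-cancelˡ-≡ (lo g) _ _ (trans (sym eq) (trans (cong suc (+-assoc (lo g) i j)) (sym (+-suc (lo g) (i + j)))))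

splits-hi : ∀ g → Splits z g i j → hi g ≡ z + suc j
splits-hi {i = i} {j = j} g (refl , eq) = begin
  suc (lo g + len g)         ≡⟨ cong (λ l → suc (lo g + l)) eq ⟩
  suc (lo g + suc (i + j))   ≡⟨ cong suc (+-assoc (lo g) (suc i) j) ⟨
  suc (lo g + suc i + j)     ≡⟨ +-suc (lo g + suc i) j ⟨
  lo g + suc i + suc j       ∎
  where open ≡-Reasoning

splits⇒inside : ∀ g → Splits z g i j → Inside z g
splits⇒inside {z} {i} {j} g s@(refl , _) =
  m<m+n (lo g) (s≤s z≤n) , subst (z <_) (sym (splits-hi g s)) (m<m+n z (s≤s z≤n))

leftGap : Gap → ℕ → Gap
leftGap g i = gap (lo g) i

rightGap : ℕ → ℕ → Gap
rightGap z j = gap z j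

hi-leftGap : ∀ g → Splits z g i j → hi (leftGap g i) ≡ z
hi-leftGap g (refl , _) = sym (+-suc (lo g) _)

hi-rightGap : ∀ g → Splits z g i j → hi (rightGap z j) ≡ hi g
hi-rightGap {z} {i} {j} g s = trans (sym (+-suc z j)) (sym (splits-hi g s))

leftGap⊆ : ∀ g → Splits z g i j → ∀ {w} → Inside w (leftGap g i) → w < z × Inside w g
leftGap⊆ g s {w} (lo<w , w<z) = w<z′ , lo<w , <-trans w<z′ (proj₂ (splits⇒inside g s))
  where w<z′ = subst (w <_) (hi-leftGap g s) w<z

rightGap⊆ : ∀ g → Splits z g i j → ∀ {w} → Inside w (rightGap z j) → z < w × Inside w g
rightGap⊆ g s {w} (z<w , w<hi) =
  z<w , <-trans (proj₁ (splits⇒inside g s)) z<w , subst (w <_) (hi-rightGap g s) w<hi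

-- Distances

Taken : Occupied n → ℕ → Set
Taken occ z = ∃ λ y → y ∈ toList occ × toℕ y ≡ z

distance-≤ : ∀ (occ : Occupied n) x {y} → y ∈ toList occ → distance occ x ≤ ∣ toℕ x - toℕ y ∣
distance-≤ (y List⁺.∷ ys) = go y ys
  where
  go : ∀ y ys x {w : Fin n} → w ∈ y ∷ ys → distance (y List⁺.∷ ys) x ≤ ∣ toℕ x - toℕ w ∣
  go y []        x (here refl)  = ≤-refl
  go y (y′ ∷ ys) x (here refl)  = m⊓n≤m _ _
  go y (y′ ∷ ys) x (there w∈)   = ≤-trans (m⊓n≤n _ _) (go y′ ys x w∈)

distance-attained : ∀ (occ : Occupied n) x → ∃ λ y → y ∈ toList occ × distance occ x ≡ ∣ toℕ x - toℕ y ∣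
distance-attained (y List⁺.∷ ys) = go y ys
  where
  go : ∀ y ys (x : Fin n) → ∃ λ w → w ∈ y ∷ ys × distance (y List⁺.∷ ys) x ≡ ∣ toℕ x - toℕ w ∣
  go y []        x = y , here refl , refl
  go y (y′ ∷ ys) x with ⊓-sel ∣ toℕ x - toℕ y ∣ (distance (y′ List⁺.∷ ys) x) | go y′ ys x
  ... | inj₁ eq | _             = y , here refl , eq
  ... | inj₂ eq | w , w∈ , eq′  = w , there w∈ , trans eq eq′

-- States of the row

record Gaps (occ : Occupied n) (gs : List Gap) : Set where
  field
    ends     : All (λ g → Taken occ (lo g) × Taken occ (hi g)) gs
    free     : All (λ g → ∀ {x} → Inside (toℕ x) g → Empty occ x) gs
    cover    : ∀ {x} → Empty occ x → Any (Inside (toℕ x)) gs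
    disjoint : AllPairs Disjoint gs
open Gaps

taken-∷⁺ : ∀ {occ : Occupied n} {x} → Taken occ z → Taken (x ∷⁺ occ) z
taken-∷⁺ (y , y∈ , eq) = y , there y∈ , eq

module _ {occ : Occupied n} {x : Fin n} where

  empty-∷⁺ : ∀ {y} → Empty occ y → toℕ y ≢ toℕ x → Empty (x ∷⁺ occ) y
  empty-∷⁺ y∉ y≢x (here y≡x) = y≢x (cong toℕ y≡x)
  empty-∷⁺ y∉ y≢x (there y∈) = y∉ y∈

  gaps-split : Gaps occ (g ∷ gs) → Splits (toℕ x) g i j →
               Gaps (x ∷⁺ occ) (leftGap g i ∷ rightGap (toℕ x) j ∷ gs)
  gaps-split {g} {gs} {i} {j} G s = record
    { ends = let (l , r) = All.head (ends G) in
        (taken-∷⁺ l , x , here refl , sym (hi-leftGap g s)) ∷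
        ((x , here refl , refl) , subst (Taken _) (sym (hi-rightGap g s)) (taken-∷⁺ r)) ∷
        All.map (λ (l , r) → taken-∷⁺ l , taken-∷⁺ r) (All.tail (ends G))
    ; free =
        (λ w∈ → let (w<x , w∈g) = leftGap⊆ g s w∈ in empty-∷⁺ (All.head (free G) w∈g) (<⇒≢ w<x)) ∷
        (λ w∈ → let (x<w , w∈g) = rightGap⊆ g s w∈ in empty-∷⁺ (All.head (free G) w∈g) (>⇒≢ x<w)) ∷
        All.zipWith (λ (dis , fr) {_} w∈ → empty-∷⁺ (fr w∈) (λ w≡x → dis x∈g (subst (λ v → Inside v _) w≡x w∈)))
          (apart , All.tail (free G))
    ; cover = cov
    ; disjoint =
        ((λ w∈l w∈r → <-asym (proj₁ (leftGap⊆ g s w∈l)) (proj₁ (rightGap⊆ g s w∈r))) ∷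
          All.map (λ dis {_} w∈l → dis (proj₂ (leftGap⊆ g s w∈l))) apart) ∷
        All.map (λ dis {_} w∈r → dis (proj₂ (rightGap⊆ g s w∈r))) apart ∷
        rest
    }
    where
    x∈g : Inside (toℕ x) g
    x∈g = splits⇒inside g s
    apart : All (Disjoint g) gs
    apart with disjoint G
    ... | p ∷ _ = p
    rest : AllPairs Disjoint gs
    rest with disjoint G
    ... | _ ∷ p = p
    cov : ∀ {y} → Empty (x ∷⁺ occ) y → Any (Inside (toℕ y)) (leftGap g i ∷ rightGap (toℕ x) j ∷ gs)
    cov {y} y∉ with cover G (y∉ ∘ there)
    ... | there any = there (there any)
    ... | here (lo<y , y<hi) with <-cmp (toℕ y) (toℕ x)
    ...   | tri< y<x _ _ = here (lo<y , subst (toℕ y <_) (sym (hi-leftGap g s)) y<x)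
    ...   | tri≈ _ y≡x _ = contradiction (here (toℕ-injective y≡x)) y∉
    ...   | tri> _ _ x<y = there (here (x<y , subst (toℕ y <_) (sym (hi-rightGap g s)) y<hi))

-- Nearly equal parts, and uniqueness of runs

⌈n/2⌉≤1+⌊n/2⌋ : ∀ m → ⌈ m /2⌉ ≤ suc ⌊ m /2⌋
⌈n/2⌉≤1+⌊n/2⌋ m = ⌊n/2⌋≤⌈n/2⌉ (suc m)

balanced-suc : Balanced i j → Balanced (suc i) (suc j)
balanced-suc (equal i) = equal (suc i)
balanced-suc (right i) = right (suc i)
balanced-suc (left i)  = left (suc i)

-- Taking `k` away from both numbers leaves at most 1 altogether.
balanced-intro : ∀ k {i j} → k ≤ i → k ≤ j → i + j ≤ suc (k + k) → Balanced i j
balanced-intro zero    {zero}        {zero}        _ _ _ = equal 0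
balanced-intro zero    {zero}        {suc zero}    _ _ _ = right 0
balanced-intro zero    {suc zero}    {zero}        _ _ _ = left 0
balanced-intro zero    {zero}        {suc (suc j)} _ _ (s≤s ())
balanced-intro zero    {suc zero}    {suc j}       _ _ (s≤s ())
balanced-intro zero    {suc (suc i)} {j}           _ _ (s≤s ())
balanced-intro (suc k) {suc i} {suc j} (s≤s k≤i) (s≤s k≤j) le = balanced-suc (balanced-intro k k≤i k≤j
  (≤-pred (≤-pred (subst (_≤ suc (suc (suc (k + k)))) (cong suc (+-suc i j))
    (subst (suc i + suc j ≤_) (cong (suc ∘ suc) (+-suc k k)) le)))))

balanced-⊓ : Balanced i j → i ⊓ j ≡ ⌊ i + j /2⌋
balanced-⊓ (equal i) = trans (⊓-idem i) (n≡⌊n+n/2⌋ i)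
balanced-⊓ (right i) rewrite +-suc i i = trans (m≤n⇒m⊓n≡m (n≤1+n i)) (n≡⌈n+n/2⌉ i)
balanced-⊓ (left i)  = trans (m≥n⇒m⊓n≡n (n≤1+n i)) (n≡⌈n+n/2⌉ i)

⊓≤⌊+/2⌋ : ∀ i j → i ⊓ j ≤ ⌊ i + j /2⌋
⊓≤⌊+/2⌋ i j = subst (_≤ ⌊ i + j /2⌋) (sym (n≡⌊n+n/2⌋ (i ⊓ j)))
  (⌊n/2⌋-mono (+-mono-≤ (m⊓n≤m i j) (m⊓n≤n i j)))

-- Two empty blocks through a common place `x` join to an empty block from the left end of one to
-- the right end of the other. Maximality then forbids either run to reach beyond the other on
-- either side.
runOf-unique : ∀ (occ : Occupied n) {x a b a′ b′} → RunOf occ x a b → RunOf occ x a′ b′ → a ≡ a′ × b ≡ b′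
runOf-unique occ {x} {a} {b} {a′} {b′} ((block , maximal) , a≤x , x≤b) ((block′ , maximal′) , a′≤x , x≤b′) =
  [ (λ a≤a′ → proj₁ (maximal′ a b′ a≤a′ ≤-refl (join block block′ a≤x x≤b a′≤x x≤b′)))
  , (λ a′≤a → sym (proj₁ (maximal a′ b a′≤a ≤-refl (join block′ block a′≤x x≤b′ a≤x x≤b)))) ]′ (≤-total (toℕ a) (toℕ a′)) ,
  [ (λ b≤b′ → sym (proj₂ (maximal a b′ ≤-refl b≤b′ (join block block′ a≤x x≤b a′≤x x≤b′))))
  , (λ b′≤b → proj₂ (maximal′ a′ b ≤-refl b′≤b (join block′ block a′≤x x≤b′ a≤x x≤b))) ]′ (≤-total (toℕ b) (toℕ b′))
  where
  join : ∀ {a b c d} → EmptyBlock occ a b → EmptyBlock occ c d →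
         a Fin.≤ x → x Fin.≤ b → c Fin.≤ x → x Fin.≤ d → EmptyBlock occ a d
  join (_ , free₁) (_ , free₂) a≤x x≤b c≤x x≤d = ≤-trans a≤x x≤d , λ z a≤z z≤d →
    [ (λ z≤x → free₁ z a≤z (≤-trans z≤x x≤b)) , (λ x≤z → free₂ z (≤-trans c≤x x≤z) z≤d) ]′ (≤-total (toℕ z) (toℕ x))

-- The choices of the two rules in terms of gaps

module _ {occ : Occupied n} {gs : List Gap} (G : Gaps occ gs) where

  place : g ∈ gs → Inside z g → ∃ λ (y : Fin n) → toℕ y ≡ z
  place {g} g∈ (_ , z<hi) with All.lookup (ends G) g∈
  ... | _ , y , _ , eq = fromℕ< z<n , toℕ-fromℕ< z<n
    where z<n = <-trans z<hi (subst (_< n) eq (toℕ<n y))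

  -- The ends of the gap give the upper bound. Every occupied place lies at or beyond one of them,
  -- because the inside is free, and this gives the lower bound.
  distance-inside : ∀ {x} → g ∈ gs → Splits (toℕ x) g i j → distance occ x ≡ suc (i ⊓ j)
  distance-inside {g} {i} {j} {x} g∈ s@(x≡ , _) = ≤-antisym
    (⊓-glb (subst (distance occ x ≤_) to-lo (distance-≤ occ x (proj₁ (proj₂ l))))
           (subst (distance occ x ≤_) to-hi (distance-≤ occ x (proj₁ (proj₂ r)))))
    below
    where
    l = proj₁ (All.lookup (ends G) g∈)
    r = proj₂ (All.lookup (ends G) g∈)
    to-lo : ∣ toℕ x - toℕ (proj₁ l) ∣ ≡ suc i
    to-lo rewrite proj₂ (proj₂ l) | x≡ = trans (∣-∣-comm (lo g + suc i) (lo g)) (∣m-m+n∣≡n (lo g) (suc i))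
    to-hi : ∣ toℕ x - toℕ (proj₁ r) ∣ ≡ suc j
    to-hi rewrite proj₂ (proj₂ r) | splits-hi g s = ∣m-m+n∣≡n (toℕ x) (suc j)
    below : suc (i ⊓ j) ≤ distance occ x
    below with distance-attained occ x
    ... | y , y∈ , eq rewrite eq with ≤-<-connex (toℕ y) (lo g) | ≤-<-connex (hi g) (toℕ y)
    ...   | inj₁ y≤lo | _ = begin
      suc (i ⊓ j)               ≤⟨ s≤s (m⊓n≤m i j) ⟩
      suc i                     ≡⟨ m+n∸m≡n (lo g) (suc i) ⟨
      lo g + suc i ∸ lo g       ≡⟨ cong (_∸ lo g) x≡ ⟨
      toℕ x ∸ lo g              ≤⟨ ∸-monoʳ-≤ (toℕ x) y≤lo ⟩
      toℕ x ∸ toℕ y             ≤⟨ m∸n≤∣m-n∣ (toℕ x) (toℕ y) ⟩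
      ∣ toℕ x - toℕ y ∣         ∎
      where open ≤-Reasoning
    ...   | inj₂ _ | inj₁ hi≤y = begin
      suc (i ⊓ j)               ≤⟨ s≤s (m⊓n≤n i j) ⟩
      suc j                     ≡⟨ m+n∸m≡n (toℕ x) (suc j) ⟨
      toℕ x + suc j ∸ toℕ x     ≡⟨ cong (_∸ toℕ x) (splits-hi g s) ⟨
      hi g ∸ toℕ x              ≤⟨ ∸-monoˡ-≤ (toℕ x) hi≤y ⟩
      toℕ y ∸ toℕ x             ≤⟨ m∸n≤∣m-n∣ (toℕ y) (toℕ x) ⟩
      ∣ toℕ y - toℕ x ∣         ≡⟨ ∣-∣-comm (toℕ y) (toℕ x) ⟩
      ∣ toℕ x - toℕ y ∣         ∎
      where open ≤-Reasoning
    ...   | inj₂ lo<y | inj₂ y<hi = contradiction y∈ (All.lookup (free G) g∈ (lo<y , y<hi))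

  empty⇒splits : ∀ {x} → Empty occ x → ∃ λ g → g ∈ gs × ∃₂ (Splits (toℕ x) g)
  empty⇒splits x∉ = let g , g∈ , inside = find (cover G x∉) in g , g∈ , inside⇒splits g inside

  splits⇒empty : ∀ {x} → g ∈ gs → Splits (toℕ x) g i j → Empty occ x
  splits⇒empty {g} g∈ s = All.lookup (free G) g∈ (splits⇒inside g s)

  place-splits : g ∈ gs → len g ≡ suc (i + j) → ∃ λ (y : Fin n) → Splits (toℕ y) g i j
  place-splits {g} {i} {j} g∈ eq =
    let y , y≡ = place g∈ (splits⇒inside g (refl , eq)) in y , y≡ , eq

  middle-place : ∀ {m} → g ∈ gs → len g ≡ suc m → ∃ λ (y : Fin n) → Splits (toℕ y) g ⌊ m /2⌋ ⌈ m /2⌉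
  middle-place {m = m} g∈ eq = place-splits g∈ (trans eq (cong suc (sym (⌊n/2⌋+⌈n/2⌉≡n m))))

  distance-middle : ∀ {m y} → g ∈ gs → Splits (toℕ y) g ⌊ m /2⌋ ⌈ m /2⌉ → distance occ y ≡ suc ⌊ m /2⌋
  distance-middle {m = m} g∈ s = trans (distance-inside g∈ s) (cong suc (m≤n⇒m⊓n≡m (⌊n/2⌋≤⌈n/2⌉ m)))

  -- The middle place of the same gap is the rival: it is empty and has distance ⌊m/2⌋ + 1, so each
  -- of the two parts around `x` must have at least ⌊m/2⌋ of the `m` remaining places.
  basic⇒balanced : ∀ {x} → BasicRule occ x → g ∈ gs → Splits (toℕ x) g i j → Balanced i j
  basic⇒balanced {g} {i} {j} {x} (_ , farthest) g∈ s@(_ , eq) =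
    balanced-intro ⌊ m /2⌋ (≤-trans ≤⊓ (m⊓n≤m i j)) (≤-trans ≤⊓ (m⊓n≤n i j))
      (begin
        m                          ≡⟨ ⌊n/2⌋+⌈n/2⌉≡n m ⟨
        ⌊ m /2⌋ + ⌈ m /2⌉          ≤⟨ +-monoʳ-≤ ⌊ m /2⌋ (⌈n/2⌉≤1+⌊n/2⌋ m) ⟩
        ⌊ m /2⌋ + suc ⌊ m /2⌋      ≡⟨ +-suc ⌊ m /2⌋ ⌊ m /2⌋ ⟩
        suc (⌊ m /2⌋ + ⌊ m /2⌋)    ∎)
    where
    open ≤-Reasoning
    m = i + j
    mid = middle-place g∈ eq
    ≤⊓ : ⌊ m /2⌋ ≤ i ⊓ j
    ≤⊓ = ≤-pred (begin
      suc ⌊ m /2⌋             ≡⟨ distance-middle g∈ (proj₂ mid) ⟨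
      distance occ (proj₁ mid) ≤⟨ farthest _ (splits⇒empty g∈ (proj₂ mid)) ⟩
      distance occ x          ≡⟨ distance-inside g∈ s ⟩
      suc (i ⊓ j)             ∎)

  -- The run goes from lo + 1 to hi - 1; a longer block would contain `lo` or `hi`, which are
  -- occupied.
  gap-run : ∀ {x} → g ∈ gs → Splits (toℕ x) g i j → ∃₂ λ a b → RunOf occ x a b × blockLength a b ≡ len g
  gap-run {g} {i} {j} {x} g∈ s@(_ , len≡) = first , last , ((block , maximal) , a≤x , x≤b) , size
    where
    lo<x = proj₁ (splits⇒inside g s)
    x<hi = proj₂ (splits⇒inside g s)
    pa = place {z = suc (lo g)} g∈ (≤-refl , ≤-<-trans lo<x x<hi)
    pb = place {z = lo g + len g} g∈ (<-≤-trans lo<x (≤-pred x<hi) , ≤-refl)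
    first = proj₁ pa
    last = proj₁ pb
    a≤x : toℕ first ≤ toℕ x
    a≤x = ≤-trans (≤-reflexive (proj₂ pa)) lo<x
    x≤b : toℕ x ≤ toℕ last
    x≤b = ≤-trans (≤-pred x<hi) (≤-reflexive (sym (proj₂ pb)))
    block : EmptyBlock occ first last
    block = ≤-trans a≤x x≤b , λ z a≤z z≤b → All.lookup (free G) g∈
      (≤-trans (≤-reflexive (sym (proj₂ pa))) a≤z , s≤s (≤-trans z≤b (≤-reflexive (proj₂ pb))))
    maximal : ∀ a′ b′ → a′ Fin.≤ first → last Fin.≤ b′ → EmptyBlock occ a′ b′ → a′ ≡ first × b′ ≡ last
    maximal a′ b′ a′≤a b≤b′ (_ , empty) with All.lookup (ends G) g∈
    ... | (l , l∈ , l≡) , (r , r∈ , r≡) =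
      toℕ-injective (≤-antisym a′≤a (≤-trans (≤-reflexive (proj₂ pa)) (≰⇒> λ a′≤lo →
        empty l (≤-trans a′≤lo (≤-reflexive (sym l≡)))
                (≤-trans (≤-reflexive l≡) (≤-trans (<⇒≤ lo<x) (≤-trans x≤b b≤b′))) l∈))) ,
      toℕ-injective (≤-antisym (≤-trans (≤-pred (≰⇒> λ hi≤b′ →
        empty r (≤-trans a′≤a (≤-trans a≤x (≤-trans (<⇒≤ x<hi) (≤-reflexive (sym r≡)))))
                (≤-trans (≤-reflexive r≡) hi≤b′) r∈)) (≤-reflexive (sym (proj₂ pb)))) b≤b′)
    size : blockLength first last ≡ len g
    size rewrite proj₂ pa | proj₂ pb | len≡ | +-suc (lo g) (i + j) = cong suc (m+n∸m≡n (lo g) (i + j))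

  runOf-length : ∀ {x a b} → g ∈ gs → Splits (toℕ x) g i j → RunOf occ x a b → blockLength a b ≡ len g
  runOf-length g∈ s run with gap-run g∈ s
  ... | a , b , run′ , eq with runOf-unique occ run run′
  ...   | refl , refl = eq

  module _ {m : ℕ} (longest : All (λ g → len g ≤ suc m) gs) where

    distance-bound : ∀ {y} → Empty occ y → distance occ y ≤ suc ⌊ m /2⌋
    distance-bound {y} y∉ with empty⇒splits y∉
    ... | g , g∈ , i , j , s = begin
      distance occ y     ≡⟨ distance-inside g∈ s ⟩
      suc (i ⊓ j)        ≤⟨ s≤s (⊓≤⌊+/2⌋ i j) ⟩
      suc ⌊ i + j /2⌋    ≤⟨ s≤s (⌊n/2⌋-mono (≤-pred (≤-trans (≤-reflexive (sym (proj₂ s))) (All.lookup longest g∈)))) ⟩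
      suc ⌊ m /2⌋        ∎
      where open ≤-Reasoning

    middle⇒basic : ∀ {x} → g ∈ gs → Splits (toℕ x) g i j → Balanced i j → i + j ≡ m → BasicRule occ x
    middle⇒basic {i = i} {j = j} g∈ s bal refl = splits⇒empty g∈ s , λ y y∉ →
      ≤-trans (distance-bound y∉) (≤-reflexive (sym (trans (distance-inside g∈ s) (cong suc (balanced-⊓ bal)))))

    middle⇒modified : ∀ {x} → g ∈ gs → Splits (toℕ x) g i j → Balanced i j → i + j ≡ m → ModifiedRule occ x
    middle⇒modified {g} g∈ s bal eq = middle⇒basic g∈ s bal eq , run (gap-run g∈ s)
      where
      run : _ → _
      run (a , b , r , size) = a , b , r , λ y (y∉ , _) a′ b′ r′ →
        let h , h∈ , k , l , t = empty⇒splits y∉ in begin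
          blockLength a′ b′ ≡⟨ runOf-length h∈ t r′ ⟩
          len h             ≤⟨ All.lookup longest h∈ ⟩
          suc m             ≡⟨ cong suc eq ⟨
          suc _             ≡⟨ proj₂ s ⟨
          len g             ≡⟨ size ⟨
          blockLength a b   ∎
        where open ≤-Reasoning

    -- Maximal distance alone also admits a gap of length `m` when `suc m` is even. The clause on
    -- runs excludes it: the middle place of `h` is a basic choice, so the run chosen must be at
    -- least as long as `h`.
    modified⇒middle : h ∈ gs → len h ≡ suc m → ∀ {x} → ModifiedRule occ x →
                      ∃ λ g → g ∈ gs × ∃₂ λ i j → Splits (toℕ x) g i j × Balanced i j × i + j ≡ m
    modified⇒middle {h} h∈ h≡ {x} (basic , a , b , run , longer) with empty⇒splits (proj₁ basic)
    ... | g , g∈ , i , j , s = g , g∈ , i , j , s , basic⇒balanced basic g∈ s , ≤-antisym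
        (≤-pred (≤-trans (≤-reflexive (sym (proj₂ s))) (All.lookup longest g∈)))
        (≤-pred (begin
          suc m             ≡⟨ h≡ ⟨
          len h             ≡⟨ proj₂ (proj₂ (proj₂ run′)) ⟨
          blockLength (proj₁ run′) (proj₁ (proj₂ run′)) ≤⟨ longer (proj₁ mid) mid-basic (proj₁ run′) (proj₁ (proj₂ run′)) (proj₁ (proj₂ (proj₂ run′))) ⟩
          blockLength a b   ≡⟨ runOf-length g∈ s run ⟩
          len g             ≡⟨ proj₂ s ⟩
          suc (i + j)       ∎))
      where
      open ≤-Reasoning
      mid = middle-place h∈ h≡
      run′ = gap-run h∈ (proj₂ mid)
      mid-basic : BasicRule occ (proj₁ mid)
      mid-basic = splits⇒empty h∈ (proj₂ mid) , λ y y∉ →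
        ≤-trans (distance-bound y∉) (≤-reflexive (sym (distance-middle h∈ (proj₂ mid))))

-- Middle places

halves-balanced : ∀ m → Balanced ⌊ m /2⌋ ⌈ m /2⌉
halves-balanced zero          = equal 0
halves-balanced (suc zero)    = right 0
halves-balanced (suc (suc m)) = balanced-suc (halves-balanced m)

-- Balanced splits with the two parts eliminated, a decidable form that can be counted over all
-- places. The two alternatives coincide when `m` is even.
MiddleOf : ℕ → Gap → Fin n → Set
MiddleOf m g x = len g ≡ suc m × (toℕ x ≡ lo g + suc ⌊ m /2⌋ ⊎ toℕ x ≡ lo g + suc ⌈ m /2⌉)

middleOf? : ∀ m g → Decidable (MiddleOf {n} m g)
middleOf? m g x = (len g ≟ suc m) ×-dec ((toℕ x ≟ lo g + suc ⌊ m /2⌋) ⊎-dec (toℕ x ≟ lo g + suc ⌈ m /2⌉))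

middleOf⇒splits : ∀ {m g} {x : Fin n} → MiddleOf m g x →
                  ∃₂ λ i j → Splits (toℕ x) g i j × Balanced i j × i + j ≡ m
middleOf⇒splits {m = m} (len≡ , inj₁ x≡) = ⌊ m /2⌋ , ⌈ m /2⌉ ,
  (x≡ , trans len≡ (cong suc (sym (⌊n/2⌋+⌈n/2⌉≡n m)))) , halves-balanced m , ⌊n/2⌋+⌈n/2⌉≡n m
middleOf⇒splits {m = m} (len≡ , inj₂ x≡) = ⌈ m /2⌉ , ⌊ m /2⌋ ,
  (x≡ , trans len≡ (cong suc (sym halves))) , balanced-sym (halves-balanced m) , halves
  where halves = trans (+-comm ⌈ m /2⌉ ⌊ m /2⌋) (⌊n/2⌋+⌈n/2⌉≡n m)

splits⇒middleOf : ∀ {m g} {x : Fin n} → Splits (toℕ x) g i j → Balanced i j → i + j ≡ m → MiddleOf m g x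
splits⇒middleOf {g = g} (x≡ , len≡) bal refl with balanced-halves bal
... | inj₁ (eq , _) = len≡ , inj₁ (trans x≡ (cong (λ k → lo g + suc k) (sym eq)))
... | inj₂ (_ , eq) = len≡ , inj₂ (trans x≡ (cong (λ k → lo g + suc k) (sym eq)))

middleOf⇒inside : ∀ {m g} {x : Fin n} → MiddleOf m g x → Inside (toℕ x) g
middleOf⇒inside {g = g} mid = let _ , _ , s , _ = middleOf⇒splits mid in splits⇒inside g s

module _ {n} {m : ℕ} {g : Gap} (place-in : ∀ {z} → Inside z g → ∃ λ (y : Fin n) → toℕ y ≡ z) where

  private
    count-toℕ : {P : Fin n → Set} (P? : Decidable P) (y : Fin n) → (∀ {x} → P x → x ≡ y) → P y →
                count P? (allFin n) ≡ 1
    count-toℕ P? y only py = count-single P? only py (allFin⁺ n) (∈-allFin y)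

    count-middles : len g ≡ suc m → (hm : Half m) → count (middleOf? m g) (allFin n) ≡ middles hm
    count-middles len≡ hm = go hm refl
      where
      p q : ℕ
      p = lo g + suc ⌊ m /2⌋
      q = lo g + suc ⌈ m /2⌉
      py : ∃ λ (y : Fin n) → toℕ y ≡ p
      py = place-in (splits⇒inside {i = ⌊ m /2⌋} {⌈ m /2⌉} g
             (refl , trans len≡ (cong suc (sym (⌊n/2⌋+⌈n/2⌉≡n m)))))
      qy : ∃ λ (y : Fin n) → toℕ y ≡ q
      qy = place-in (splits⇒inside {i = ⌈ m /2⌉} {⌊ m /2⌋} g
             (refl , trans len≡ (cong suc (sym (trans (+-comm ⌈ m /2⌉ ⌊ m /2⌋) (⌊n/2⌋+⌈n/2⌉≡n m))))))
      go : ∀ {l} (hl : Half l) → l ≡ m → count (middleOf? m g) (allFin n) ≡ middles hl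
      go (even k) eq = count-toℕ (middleOf? m g) (proj₁ py)
        (λ { (_ , inj₁ x≡) → toℕ-injective (trans x≡ (sym (proj₂ py)))
           ; (_ , inj₂ x≡) → toℕ-injective (trans x≡ (trans (sym p≡q) (sym (proj₂ py)))) })
        (len≡ , inj₁ (proj₂ py))
        where p≡q : p ≡ q
              p≡q = cong (λ l → lo g + suc l) (subst (λ l → ⌊ l /2⌋ ≡ ⌈ l /2⌉) eq (trans (sym (n≡⌊n+n/2⌋ k)) (n≡⌈n+n/2⌉ k)))
      go (odd k) eq = trans
        (count-⊎ (middleOf? m g) (Fin._≟ proj₁ py) (Fin._≟ proj₁ qy)
          (λ { (_ , inj₁ x≡) → inj₁ (toℕ-injective (trans x≡ (sym (proj₂ py))))
             ; (_ , inj₂ x≡) → inj₂ (toℕ-injective (trans x≡ (sym (proj₂ qy)))) })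
          (λ { refl → len≡ , inj₁ (proj₂ py) })
          (λ { refl → len≡ , inj₂ (proj₂ qy) })
          (λ { refl eq′ → p≢q (trans (sym (proj₂ py)) (trans (cong toℕ eq′) (proj₂ qy))) })
          (allFin n))
        (cong₂ _+_ (count-toℕ (Fin._≟ proj₁ py) (proj₁ py) (λ eq → eq) refl)
                   (count-toℕ (Fin._≟ proj₁ qy) (proj₁ qy) (λ eq → eq) refl))
        where
        ceil : ⌈ m /2⌉ ≡ suc ⌊ m /2⌋
        ceil = subst (λ l → ⌈ l /2⌉ ≡ suc ⌊ l /2⌋) eq
                 (cong suc (trans (sym (n≡⌊n+n/2⌋ k)) (n≡⌈n+n/2⌉ k)))
        p≢q : p ≢ q
        p≢q eq = 1+n≢n (trans (sym ceil) (suc-injective (+-cancelˡ-≡ (lo g) _ _ (sym eq))))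

  count-middleOf : count (middleOf? m g) (allFin n) ≡ 𝟙 (len g ≟ suc m) * middles (half m)
  count-middleOf = go (len g ≟ suc m)
    where
    go : Dec (len g ≡ suc m) → count (middleOf? m g) (allFin n) ≡ 𝟙 (len g ≟ suc m) * middles (half m)
    go (yes len≡) = trans (count-middles len≡ (half m))
      (sym (trans (cong (_* middles (half m)) (𝟙-yes (len g ≟ suc m) len≡)) (*-identityˡ _)))
    go (no len≢)  = trans (count-none (middleOf? m g) (len≢ ∘ proj₁) (allFin n))
      (sym (cong (_* middles (half m)) (𝟙-no (len g ≟ suc m) len≢)))

-- The overview's N(r + 1) for a row whose gaps are `gs`.
total : List Gap → ℕ → ℕ
total gs r = sum (map (λ g → gapCount (len g) r) gs)

-- For the gaps of a row this is the number of empty places, hence of persons still to come; it ties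
-- the state to the length of the remaining sequence.
size : List Gap → ℕ
size gs = sum (map len gs)

total-↭ : ∀ {gs hs} → gs ↭ hs → ∀ r → total gs r ≡ total hs r
total-↭ p r = sum-↭ (map⁺ _ p)

size-↭ : ∀ {gs hs} → gs ↭ hs → size gs ≡ size hs
size-↭ p = sum-↭ (map⁺ len p)

len≤size : g ∈ gs → len g ≤ size gs
len≤size (here refl) = m≤m+n _ _
len≤size (there g∈)  = ≤-trans (len≤size g∈) (m≤n+m _ _)

total-empty : ∀ gs → size gs ≡ 0 → ∀ r → total gs r ≡ 0
total-empty []       _  r = refl
total-empty (g ∷ gs) eq r rewrite m+n≡0⇒m≡0 (len g) eq = total-empty gs (m+n≡0⇒n≡0 (len g) eq) r

-- Gaps are disjoint, so no place is a middle of two of them and the counts add up. No length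
-- exceeds `suc m`, so the indicator of a longest gap may be replaced by `gapCount`.
count-any-middleOf : ∀ {m} gs → (∀ {g z} → g ∈ gs → Inside z g → ∃ λ (y : Fin n) → toℕ y ≡ z) →
                     AllPairs Disjoint gs → All (λ g → len g ≤ suc m) gs →
                     count (λ x → Any.any? (λ g → middleOf? m g x) gs) (allFin n) ≡ total gs m * middles (half m)
count-any-middleOf {n} {m} [] _ _ _ = count-none _ (λ ()) (allFin n)
count-any-middleOf {n} {m} (g ∷ gs) place-in (apart ∷ dis) (g≤ ∷ gs≤) = begin
  count (λ x → Any.any? (λ g → middleOf? m g x) (g ∷ gs)) (allFin n)
    ≡⟨ count-⊎ _ (middleOf? m g) (λ x → Any.any? (λ g → middleOf? m g x) gs)
         (λ { (here p) → inj₁ p ; (there p) → inj₂ p }) here there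
         (λ p q → let h , h∈ , r = find q in All.lookup apart h∈ (middleOf⇒inside p) (middleOf⇒inside r))
         (allFin n) ⟩
  count (middleOf? m g) (allFin n) + count (λ x → Any.any? (λ g → middleOf? m g x) gs) (allFin n)
    ≡⟨ cong₂ _+_ (trans (count-middleOf (place-in (here refl))) (cong (_* middles (half m)) (sym (gapCount-maximal g≤))))
                 (count-any-middleOf gs (place-in ∘ there) dis gs≤) ⟩
  gapCount (len g) m * middles (half m) + total gs m * middles (half m)
    ≡⟨ *-distribʳ-+ (middles (half m)) (gapCount (len g) m) (total gs m) ⟨
  total (g ∷ gs) m * middles (half m) ∎
  where open ≡-Reasoning

count-modified : ∀ {occ : Occupied n} {m} → Gaps occ gs → All (λ g → len g ≤ suc m) gs → h ∈ gs → len h ≡ suc m →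
                 count (modifiedRule? occ) (allFin n) ≡ total gs m * middles (half m)
count-modified {n} {gs} {occ = occ} G longest h∈ h≡ = trans
  (count-cong (modifiedRule? occ) _
    (λ mod → let g , g∈ , i , j , s , bal , eq = modified⇒middle G longest h∈ h≡ mod in lose g∈ (splits⇒middleOf s bal eq))
    (λ any → let g , g∈ , mid = find any
                 i , j , s , bal , eq = middleOf⇒splits mid
             in middle⇒modified G longest g∈ s bal eq)
    (allFin n))
  (count-any-middleOf gs (place G) (disjoint G) longest)

-- One step of a filling

gaps-↭ : ∀ {occ : Occupied n} {gs hs} → gs ↭ hs → Gaps occ gs → Gaps occ hs
gaps-↭ p G = record
  { ends     = All-resp-↭ p (ends G)
  ; free     = All-resp-↭ p (free G)
  ; cover    = λ x∉ → Any-resp-↭ p (cover G x∉)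
  ; disjoint = Permutation.AllPairs-resp-↭ (setoid Gap) (λ dis {_} z∈h z∈g → dis z∈g z∈h)
                 ((λ { refl dis {_} → dis }) , (λ { refl dis {_} → dis })) (↭⇒↭ₛ p) (disjoint G)
  }

focus : g ∈ gs → ∃ λ rest → gs ↭ g ∷ rest
focus g∈ with ∈-∃++ g∈
... | ys , zs , refl = ys ++ zs , shift _ ys zs

record Step (occ : Occupied n) (x : Fin n) (gs : List Gap) (g : Gap) (i j : ℕ) : Set where
  field
    others     : List Gap
    before     : gs ↭ g ∷ others
  after : List Gap
  after = leftGap g i ∷ rightGap (toℕ x) j ∷ others
  field
    gaps-after : Gaps (x ∷⁺ occ) after
    size-step  : size gs ≡ suc (size after)
    total-step : ∀ r → total gs r ≡ 𝟙 (i + j ≟ r) + total after r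

-- Balance makes the two new gaps the halves in the recursion of `gapCount`. The gap `g` may be any
-- one in the list, so the same step serves both rules.
step : ∀ {occ : Occupied n} {x} → Gaps occ gs → g ∈ gs → Splits (toℕ x) g i j → Balanced i j → Step occ x gs g i j
step {gs = gs} {g = g} {i = i} {j = j} {x = x} G g∈ s@(_ , len≡) bal with focus g∈
... | others , p = record
  { others     = others
  ; before     = p
  ; gaps-after = gaps-split (gaps-↭ p G) s
  ; size-step  = begin
      size gs                          ≡⟨ size-↭ p ⟩
      len g + size others              ≡⟨ cong (_+ size others) len≡ ⟩
      suc (i + j + size others)        ≡⟨ cong suc (+-assoc i j (size others)) ⟩
      suc (i + (j + size others))      ∎
  ; total-step = λ r → begin
      total gs r                                                         ≡⟨ total-↭ p r ⟩
      gapCount (len g) r + total others r                                ≡⟨ cong (λ l → gapCount l r + total others r) len≡ ⟩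
      gapCount (suc (i + j)) r + total others r                          ≡⟨ cong (_+ total others r) (gapCount-split bal r) ⟩
      𝟙 (i + j ≟ r) + (gapCount i r + gapCount j r) + total others r     ≡⟨ solve 4 (λ a b c d → a :+ (b :+ c) :+ d := a :+ (b :+ (c :+ d))) refl
                                                                              (𝟙 (i + j ≟ r)) (gapCount i r) (gapCount j r) (total others r) ⟩
      𝟙 (i + j ≟ r) + (gapCount i r + (gapCount j r + total others r))   ∎
  }
  where open ≡-Reasoning
        open +-*-Solver

longest-gap : ∀ {s} → size gs ≡ suc s → ∃₂ λ g m → g ∈ gs × len g ≡ suc m × All (λ h → len h ≤ suc m) gs
longest-gap {g ∷ gs} eq = let m , len≡ = positive (len top) refl in
  top , m , top∈ , len≡ , All.map (λ le → ≤-trans le (≤-reflexive len≡)) bound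
  where
  top : Gap
  top = argmax len g gs
  top∈ : top ∈ g ∷ gs
  top∈ = [ here , there ]′ (argmax-sel len g gs)
  bound : All (λ h → len h ≤ len top) (g ∷ gs)
  bound = f[⊥]≤f[argmax] {f = len} g gs ∷ f[xs]≤f[argmax] {f = len} g gs
  size-zero : ∀ hs → All (λ h → len h ≤ 0) hs → size hs ≡ 0
  size-zero []       []         = refl
  size-zero (h ∷ hs) (h≤ ∷ hs≤) = cong₂ _+_ (n≤0⇒n≡0 h≤) (size-zero hs hs≤)
  positive : ∀ l → len top ≡ l → ∃ λ m → len top ≡ suc m
  positive (suc m) len≡ = m , len≡
  positive zero    len≡ = contradiction
    (trans (sym eq) (size-zero (g ∷ gs) (All.map (λ le → ≤-trans le (≤-reflexive len≡)) bound))) 1+n≢0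

-- The number of modified fillings

count-++ : {P : A → Set} (P? : Decidable P) (xs ys : List A) → count P? (xs ++ ys) ≡ count P? xs + count P? ys
count-++ P? xs ys = trans (cong length (filter-++ P? xs ys)) (length-++ (filter P? xs))

count-map : {B : Set} {P : B → Set} (P? : Decidable P) (f : A → B) (xs : List A) →
            count P? (map f xs) ≡ count (P? ∘ f) xs
count-map P? f []       = refl
count-map P? f (x ∷ xs) = begin
  count P? (map f (x ∷ xs))                ≡⟨ count-∷ P? (f x) (map f xs) ⟩
  𝟙 (P? (f x)) + count P? (map f xs)       ≡⟨ cong (𝟙 (P? (f x)) +_) (count-map P? f xs) ⟩
  𝟙 (P? (f x)) + count (P? ∘ f) xs         ≡⟨ count-∷ (P? ∘ f) x xs ⟨
  count (P? ∘ f) (x ∷ xs)                  ∎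
  where open ≡-Reasoning

module _ {A B C : Set} {f : A → B → C} {P : A → Set} {T : A → B → Set}
         (P? : Decidable P) (T? : ∀ x → Decidable (T x))
         {S : C → Set} (S? : Decidable S)
         (to : ∀ {x y} → S (f x y) → P x × T x y) (from : ∀ {x y} → P x → T x y → S (f x y))
         (ys : List B) (v : ℕ) (constant : ∀ {x} → P x → count (T? x) ys ≡ v) where
  open ≡-Reasoning

  -- The multiplication principle for successive choices: which second entries are admissible may
  -- depend on the first one, but not how many there are.
  count-cartesianProductWith : ∀ xs → count S? (cartesianProductWith f xs ys) ≡ count P? xs * v
  count-cartesianProductWith []       = refl
  count-cartesianProductWith (x ∷ xs) = begin
    count S? (map (f x) ys ++ cartesianProductWith f xs ys)              ≡⟨ count-++ S? (map (f x) ys) _ ⟩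
    count S? (map (f x) ys) + count S? (cartesianProductWith f xs ys)    ≡⟨ cong₂ _+_ (trans (count-map S? (f x) ys) (row (P? x))) (count-cartesianProductWith xs) ⟩
    𝟙 (P? x) * v + count P? xs * v                                       ≡⟨ *-distribʳ-+ v (𝟙 (P? x)) (count P? xs) ⟨
    (𝟙 (P? x) + count P? xs) * v                                         ≡⟨ cong (_* v) (count-∷ P? x xs) ⟨
    count P? (x ∷ xs) * v                                                ∎
    where
    row : Dec (P x) → count (S? ∘ f x) ys ≡ 𝟙 (P? x) * v
    row (yes px) = begin
      count (S? ∘ f x) ys ≡⟨ count-cong (S? ∘ f x) (T? x) (proj₂ ∘ to) (from px) ys ⟩
      count (T? x) ys     ≡⟨ constant px ⟩
      v                   ≡⟨ *-identityˡ v ⟨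
      1 * v               ≡⟨ cong (_* v) (𝟙-yes (P? x) px) ⟨
      𝟙 (P? x) * v        ∎
    row (no ¬px) = trans (count-none (S? ∘ f x) (¬px ∘ proj₁ ∘ to) ys) (cong (_* v) (sym (𝟙-no (P? x) ¬px)))

continuations : Occupied n → ℕ → ℕ
continuations {n} occ m = count (obeys? modifiedRule? occ) (sequences n m)

continuations-suc : ∀ (occ : Occupied n) m v → (∀ {x} → ModifiedRule occ x → continuations (x ∷⁺ occ) m ≡ v) →
                    continuations occ (suc m) ≡ count (modifiedRule? occ) (allFin n) * v
continuations-suc {n} occ m v constant =
  count-cartesianProductWith (modifiedRule? occ) (λ x → obeys? modifiedRule? (x ∷⁺ occ))
    (obeys? modifiedRule? occ) (λ p → p) _,_ (sequences n m) v constant (allFin n)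

mutual
  -- The number `c` of factors stays fixed while persons arrive, so that the products before and
  -- after a choice have the same range; `m ≤ c` ensures that the factor affected by the choice lies
  -- in it.
  continuations-weight : ∀ c m {occ : Occupied n} {gs} → Gaps occ gs → size gs ≡ m → m ≤ c →
                         continuations occ m ≡ weight c (total gs)
  continuations-weight c zero    {gs = gs} G eq _   = sym (weight-zero c (total-empty gs eq))
  continuations-weight c (suc s) {gs = gs} G eq s<c =
    let h , m , h∈ , h≡ , longest = longest-gap {gs} eq in continuations-longest c s G eq s<c h∈ h≡ longest

  continuations-longest : ∀ c s {occ : Occupied n} {gs m} → Gaps occ gs → size gs ≡ suc s → suc s ≤ c →
                          h ∈ gs → len h ≡ suc m → All (λ g → len g ≤ suc m) gs →
                          continuations occ (suc s) ≡ weight c (total gs)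
  continuations-longest {h = h} c s {occ} {gs} {m} G eq s<c h∈ h≡ longest = begin
    continuations occ (suc s)                                       ≡⟨ continuations-suc occ s (weight c N′) after-choice ⟩
    count (modifiedRule? occ) (allFin _) * weight c N′              ≡⟨ cong (_* weight c N′) (count-modified G longest h∈ h≡) ⟩
    total gs m * middles (half m) * weight c N′                     ≡⟨ weight-step c split (half m) (<-≤-trans m/2<1+s s<c) ⟨
    weight c (total gs)                                             ∎
    where
    open ≡-Reasoning
    -- This count refers to `gs` and `m` alone, so every admissible choice leads to the same number
    -- of continuations, as the multiplication principle demands. The truncated subtraction is
    -- exact: a split of `h` in its middle, carried out in `split`, shows that `total gs m` is
    -- positive.
    N′ : ℕ → ℕ
    N′ r = total gs r ∸ 𝟙 (m ≟ r)
    after-total : ∀ {x g i j} → (st : Step occ x gs g i j) → i + j ≡ m → ∀ r → total (Step.after st) r ≡ N′ r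
    after-total st refl r = sym (trans (cong (_∸ 𝟙 (m ≟ r)) (Step.total-step st r)) (m+n∸m≡n (𝟙 (m ≟ r)) _))
    after-choice : ∀ {x} → ModifiedRule occ x → continuations (x ∷⁺ occ) s ≡ weight c N′
    after-choice mod =
      let g , g∈ , i , j , sp , bal , i+j≡m = modified⇒middle G longest h∈ h≡ mod
          st = step G g∈ sp bal
      in trans (continuations-weight c s (Step.gaps-after st) (suc-injective (trans (sym (Step.size-step st)) eq)) (<⇒≤ s<c))
               (weight-cong c (after-total st i+j≡m))
    split : ∀ r → total gs r ≡ 𝟙 (m ≟ r) + N′ r
    split r =
      let x , sp = middle-place G h∈ h≡
          st = step G h∈ sp (halves-balanced m)
      in trans (Step.total-step st r)
           (cong₂ _+_ (cong (λ l → 𝟙 (l ≟ r)) (⌊n/2⌋+⌈n/2⌉≡n m)) (after-total st (⌊n/2⌋+⌈n/2⌉≡n m) r))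
    m/2<1+s : ⌊ m /2⌋ < suc s
    m/2<1+s = ≤-<-trans (⌊n/2⌋≤n m) (≤-trans (≤-reflexive (sym h≡)) (≤-trans (len≤size h∈) (≤-reflexive eq)))

-- Persons and pairs in a basic filling

-- A middle place has distance i + 1 for exactly two gap lengths, 2(i + 1) and 2(i + 1) - 1. This is
-- the source of b as a sum of two counts.
𝟙-half : ∀ m i → 𝟙 (suc ⌊ m /2⌋ ≟ suc i) ≡ 𝟙 (m ≟ suc (i + i)) + 𝟙 (m ≟ i + i)
𝟙-half m i = 𝟙-⊎ (suc ⌊ m /2⌋ ≟ suc i) (m ≟ suc (i + i)) (m ≟ i + i)
  (λ eq → cases (half m) (suc-injective eq))
  (λ { refl → cong suc (sym (n≡⌈n+n/2⌉ i)) })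
  (λ { refl → cong suc (sym (n≡⌊n+n/2⌋ i)) })
  (λ odd even → double≢1+double i i (trans (sym even) odd))
  where
  cases : ∀ {m} → Half m → ⌊ m /2⌋ ≡ i → m ≡ suc (i + i) ⊎ m ≡ i + i
  cases (even k) eq = inj₂ (cong (λ l → l + l) (trans (n≡⌊n+n/2⌋ k) eq))
  cases (odd k)  eq = inj₁ (cong (λ l → suc (l + l)) (trans (n≡⌈n+n/2⌉ k) eq))

count-chosenDistances : ∀ {m} {occ : Occupied n} {gs} → Gaps occ gs → size gs ≡ m →
                        (xs : Vec (Fin n) m) → Obeys BasicRule occ xs → ∀ i →
                        count (_≟ suc i) (chosenDistances occ xs) ≡ total gs (suc (i + i)) + total gs (i + i)
count-chosenDistances {gs = gs} G eq Vec.[] _ i = sym (cong₂ _+_ (total-empty gs eq _) (total-empty gs eq _))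
count-chosenDistances {occ = occ} {gs} G eq (x Vec.∷ xs) (basic , rest) i with empty⇒splits G (proj₁ basic)
... | g , g∈ , p , q , s = begin
  count (_≟ suc i) (distance occ x ∷ later)                        ≡⟨ count-∷ (_≟ suc i) (distance occ x) later ⟩
  𝟙 (distance occ x ≟ suc i) + count (_≟ suc i) later              ≡⟨ cong₂ _+_ (trans (cong (λ l → 𝟙 (l ≟ suc i)) dist) (𝟙-half (p + q) i)) later≡ ⟩
  (𝟙 (p + q ≟ suc (i + i)) + 𝟙 (p + q ≟ i + i)) + (total after (suc (i + i)) + total after (i + i))
                                                                   ≡⟨ solve 4 (λ a b c d → (a :+ b) :+ (c :+ d) := (a :+ c) :+ (b :+ d)) refl
                                                                        (𝟙 (p + q ≟ suc (i + i))) (𝟙 (p + q ≟ i + i)) (total after (suc (i + i))) (total after (i + i)) ⟩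
  (𝟙 (p + q ≟ suc (i + i)) + total after (suc (i + i))) + (𝟙 (p + q ≟ i + i) + total after (i + i))
                                                                   ≡⟨ cong₂ _+_ (total-step (suc (i + i))) (total-step (i + i)) ⟨
  total gs (suc (i + i)) + total gs (i + i)                        ∎
  where
  open ≡-Reasoning
  open +-*-Solver
  bal : Balanced p q
  bal = basic⇒balanced G basic g∈ s
  open Step (step G g∈ s bal)
  later = chosenDistances (x ∷⁺ occ) xs
  dist : distance occ x ≡ suc ⌊ p + q /2⌋
  dist = trans (distance-inside G g∈ s) (cong suc (balanced-⊓ bal))
  later≡ : count (_≟ suc i) later ≡ total after (suc (i + i)) + total after (i + i)
  later≡ = count-chosenDistances gaps-after (suc-injective (trans (sym size-step) eq)) xs rest i

-- Neighbouring empty places of equal distance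

TwinsAt : ℕ → Fin n × Fin n → Occupied n → Set
TwinsAt k (x , y) occ = EmptyAt k x occ × EmptyAt k y occ

-- The index i stands for the distance k = i + 1 of the two places.
MiddlePair : ℕ → Gap → Fin n × Fin n → Set
MiddlePair i g (x , y) = len g ≡ suc (suc (i + i)) × toℕ x ≡ lo g + suc i × suc (toℕ x) ≡ toℕ y

middlePair? : ∀ i g → Decidable (MiddlePair {n} i g)
middlePair? i g (x , y) = (len g ≟ suc (suc (i + i))) ×-dec ((toℕ x ≟ lo g + suc i) ×-dec (suc (toℕ x) ≟ toℕ y))

middlePair-splits : ∀ {x y : Fin n} → MiddlePair i g (x , y) →
                    Splits (toℕ x) g i (suc i) × Splits (toℕ y) g (suc i) i
middlePair-splits {i = i} {g = g} (len≡ , x≡ , 1+x≡y) =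
  (x≡ , trans len≡ (cong suc (sym (+-suc i i)))) ,
  trans (sym 1+x≡y) (trans (cong suc x≡) (sym (+-suc (lo g) (suc i)))) , len≡

module _ {occ : Occupied n} (G : Gaps occ gs) where

  middlePair⇒twins : ∀ {xy} → g ∈ gs → MiddlePair i g xy → TwinsAt (suc i) xy occ
  middlePair⇒twins {g} {i} g∈ pair =
    let s , t = middlePair-splits {g = g} pair in
    (splits⇒empty G g∈ s , trans (distance-inside G g∈ s) (cong suc (m≤n⇒m⊓n≡m (n≤1+n i)))) ,
    (splits⇒empty G g∈ t , trans (distance-inside G g∈ t) (cong suc (m≥n⇒m⊓n≡n (n≤1+n i))))

  -- Both places lie in one gap, as otherwise `y` would be its occupied end `hi`. Passing from `x`
  -- to `y` moves one place from the right part to the left; the smaller part rises or falls by one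
  -- unless `x` and `y` are the two middle places.
  twins⇒middlePair : ∀ {x y} → suc (toℕ x) ≡ toℕ y → TwinsAt (suc i) (x , y) occ →
                     ∃ λ g → g ∈ gs × MiddlePair i g (x , y)
  twins⇒middlePair {i} {x} {y} 1+x≡y ((x∉ , dx) , (y∉ , dy)) with empty⇒splits G x∉
  ... | g , g∈ , p , zero , s = contradiction (proj₁ (proj₂ r)) (subst (_∉ toList occ) y≡r y∉)
    where
    r : Taken occ (hi g)
    r = proj₂ (All.lookup (ends G) g∈)
    y≡r : y ≡ proj₁ r
    y≡r = toℕ-injective (trans (sym 1+x≡y) (trans (+-comm 1 (toℕ x)) (trans (sym (splits-hi g s)) (sym (proj₂ (proj₂ r))))))
  ... | g , g∈ , p , suc q , s@(x≡ , len≡) = g , g∈ , conclude (closer p q p⊓1+q 1+p⊓q)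
    where
    t : Splits (toℕ y) g (suc p) q
    t = trans (sym 1+x≡y) (trans (cong suc x≡) (sym (+-suc (lo g) (suc p)))) , trans len≡ (cong suc (+-suc p q))
    p⊓1+q : p ⊓ suc q ≡ i
    p⊓1+q = suc-injective (trans (sym (distance-inside G g∈ s)) dx)
    1+p⊓q : suc p ⊓ q ≡ i
    1+p⊓q = suc-injective (trans (sym (distance-inside G g∈ t)) dy)
    closer : ∀ p q → p ⊓ suc q ≡ i → suc p ⊓ q ≡ i → p ≡ i × q ≡ i
    closer p q eq₁ eq₂ with <-cmp p q
    ... | tri≈ _ refl _ = let p≡i = trans (sym (m≤n⇒m⊓n≡m (n≤1+n p))) eq₁ in p≡i , p≡i
    ... | tri< p<q _ _  = contradiction (trans (sym (m≤n⇒m⊓n≡m p<q)) (trans eq₂ (trans (sym eq₁) (m≤n⇒m⊓n≡m (<⇒≤ (m<n⇒m<1+n p<q)))))) 1+n≢n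
    ... | tri> _ _ q<p  = contradiction (trans (sym (m≥n⇒m⊓n≡n q<p)) (trans eq₁ (trans (sym eq₂) (m≥n⇒m⊓n≡n (<⇒≤ (m<n⇒m<1+n q<p)))))) 1+n≢n
    conclude : p ≡ i × q ≡ i → MiddlePair i g (x , y)
    conclude (refl , refl) = trans len≡ (cong suc (+-suc p p)) , x≡ , 1+x≡y

states-head : ∀ {m} {P : Occupied n → Set} (occ : Occupied n) (xs : Vec (Fin n) m) → P occ → Any P (states occ xs)
states-head occ Vec.[]       p = here p
states-head occ (x Vec.∷ xs) p = here p

-- Occupied places stay occupied, so a pair that is empty at some later time is empty already now.
twins-unoccupied : ∀ {m k} {x y : Fin n} (occ : Occupied n) (xs : Vec (Fin n) m) →
                   Any (TwinsAt k (x , y)) (states occ xs) → Empty occ x × Empty occ y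
twins-unoccupied occ Vec.[]       (here ((x∉ , _) , (y∉ , _))) = x∉ , y∉
twins-unoccupied occ (z Vec.∷ xs) (here ((x∉ , _) , (y∉ , _))) = x∉ , y∉
twins-unoccupied occ (z Vec.∷ xs) (there any) =
  let x∉ , y∉ = twins-unoccupied (z ∷⁺ occ) xs any in (x∉ ∘ there) , (y∉ ∘ there)

-- A gap with a middle pair has even length, and the pair consists of its only two middle places.
-- Hence whoever fills the middle of this gap destroys the pair.
middle-of-pair : ∀ {z x y : Fin n} {p q} → Splits (toℕ z) g p q → Balanced p q →
                 MiddlePair i g (x , y) → z ≡ x ⊎ z ≡ y
middle-of-pair {g = g} {i = i} (z≡ , len≡z) bal pair@(len≡ , x≡ , _) with bal
... | equal p = contradiction (suc-injective (trans (sym len≡z) len≡)) (double≢1+double p i)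
... | right p with double-injective {p} {i} (suc-injective (trans (sym (+-suc p p)) (suc-injective (trans (sym len≡z) len≡))))
...   | refl = inj₁ (toℕ-injective (trans z≡ (sym x≡)))
middle-of-pair {g = g} {i = i} (z≡ , len≡z) bal pair@(len≡ , x≡ , _) | left p
  with double-injective {p} {i} (suc-injective (suc-injective (trans (sym len≡z) len≡)))
...   | refl = inj₂ (toℕ-injective (trans z≡ (sym (proj₁ (proj₂ (middlePair-splits {g = g} pair))))))

pairs : ∀ n → List (Fin n × Fin n)
pairs n = cartesianProduct (allFin n) (allFin n)

count-middlePair : ∀ {occ : Occupied n} {m} i → Gaps occ gs → g ∈ gs → len g ≡ suc m →
                   count (middlePair? i g) (pairs n) ≡ 𝟙 (m ≟ suc (i + i))
count-middlePair {n} {gs} {g} {m = m} i G g∈ len≡m = go (m ≟ suc (i + i))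
  where
  go : Dec (m ≡ suc (i + i)) → count (middlePair? i g) (pairs n) ≡ 𝟙 (m ≟ suc (i + i))
  go (no m≢)    = trans (count-none (middlePair? i g) (λ (len≡ , _) → m≢ (suc-injective (trans (sym len≡m) len≡))) (pairs n))
                        (sym (𝟙-no (m ≟ suc (i + i)) m≢))
  go (yes refl) = trans
    (count-single (middlePair? i g) {a = x , y}
      (λ (_ , u≡ , 1+u≡v) → let u≡x = toℕ-injective (trans u≡ (sym (proj₁ s))) in
        cong₂ _,_ u≡x (toℕ-injective (trans (sym 1+u≡v) (trans (cong (suc ∘ toℕ) u≡x) 1+x≡y))))
      (len≡m , proj₁ s , 1+x≡y)
      (cartesianProduct⁺ (allFin⁺ n) (allFin⁺ n))
      (∈-cartesianProduct⁺ (∈-allFin x) (∈-allFin y)))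
    (sym (𝟙-yes (m ≟ m) refl))
    where
    px = place-splits G {i = i} {j = suc i} g∈ (trans len≡m (cong suc (sym (+-suc i i))))
    py = place-splits G {i = suc i} {j = i} g∈ len≡m
    x = proj₁ px
    y = proj₁ py
    s = proj₂ px
    1+x≡y : suc (toℕ x) ≡ toℕ y
    1+x≡y = trans (cong suc (proj₁ s)) (trans (sym (+-suc (lo g) (suc i))) (sym (proj₁ (proj₂ py))))

-- A pair may persist through many states but must be counted once, so it is charged to the person
-- who splits its gap. The pairs seen from now on are thus the middle pair of `g`, if there is one,
-- and those seen from the next state on; these are disjoint because `z` takes a place of the
-- former.
count-twins : ∀ {m} {occ : Occupied n} {gs} → Gaps occ gs → size gs ≡ m →
              (xs : Vec (Fin n) m) → Obeys BasicRule occ xs → ∀ i →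
              count (neighboursAt? (states occ xs) (suc i)) (pairs n) ≡ total gs (suc (i + i))
count-twins {n} {occ = occ} {gs} G eq Vec.[] _ i = trans
  (count-none (neighboursAt? (occ ∷ []) (suc i)) (λ { (_ , here ((x∉ , _) , _)) → none x∉ }) (pairs n))
  (sym (total-empty gs eq _))
  where
  none : ∀ {x} → ¬ Empty occ x
  none x∉ = let g , g∈ , i , j , _ , len≡ = empty⇒splits G x∉ in
    1+n≢0 (n≤0⇒n≡0 (≤-trans (≤-reflexive (sym len≡)) (≤-trans (len≤size g∈) (≤-reflexive eq))))
count-twins {n} {occ = occ} {gs} G eq (z Vec.∷ xs) (basic , rest) i with empty⇒splits G (proj₁ basic)
... | g , g∈ , p , q , s = begin
  count (neighboursAt? (occ ∷ later) (suc i)) (pairs n)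
    ≡⟨ count-⊎ (neighboursAt? (occ ∷ later) (suc i)) (middlePair? i g) (neighboursAt? later (suc i))
         now-or-later
         (λ pair@(_ , _ , 1+x≡y) → 1+x≡y , here (middlePair⇒twins G g∈ pair))
         (λ (1+x≡y , any) → 1+x≡y , there any)
         not-both (pairs n) ⟩
  count (middlePair? i g) (pairs n) + count (neighboursAt? later (suc i)) (pairs n)
    ≡⟨ cong₂ _+_ (count-middlePair i G g∈ (proj₂ s))
                 (count-twins gaps-after (suc-injective (trans (sym size-step) eq)) xs rest i) ⟩
  𝟙 (p + q ≟ suc (i + i)) + total after (suc (i + i))
    ≡⟨ total-step (suc (i + i)) ⟨
  total gs (suc (i + i)) ∎
  where
  open ≡-Reasoning
  bal : Balanced p q
  bal = basic⇒balanced G basic g∈ s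
  open Step (step G g∈ s bal)
  later = states (z ∷⁺ occ) xs
  now-or-later : ∀ {xy} → NeighboursAt (occ ∷ later) (suc i) xy → MiddlePair i g xy ⊎ NeighboursAt later (suc i) xy
  now-or-later (1+x≡y , there any)  = inj₂ (1+x≡y , any)
  now-or-later (1+x≡y , here twins) with twins⇒middlePair G 1+x≡y twins
  ... | h , h∈ , pair with ∈-resp-↭ before h∈
  ...   | here refl = inj₁ pair
  -- A pair in a gap other than `g` survives this choice and is seen again in the next state.
  ...   | there h∈′ = inj₂ (1+x≡y , states-head (z ∷⁺ occ) xs (middlePair⇒twins gaps-after (there (there h∈′)) pair))
  not-both : ∀ {xy} → MiddlePair i g xy → ¬ NeighboursAt later (suc i) xy
  not-both pair (_ , any) with twins-unoccupied (z ∷⁺ occ) xs any | middle-of-pair {g = g} s bal pair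
  ... | x∉ , _ | inj₁ refl = x∉ (here refl)
  ... | _ , y∉ | inj₂ refl = y∉ (here refl)

-- The first two persons

module _ {n : ℕ} where

  private
    last : Fin (suc (suc n))
    last = fromℕ (suc n)

    toℕ-last : toℕ last ≡ suc n
    toℕ-last = toℕ-fromℕ (suc n)

    toℕ≤ : (x : Fin (suc (suc n))) → toℕ x ≤ suc n
    toℕ≤ x = ≤-pred (toℕ<n x)

  -- The row has n + 2 places, and from one end only the other end is n + 1 away. So the second
  -- person has no choice, and a single gap of length `n` remains.
  data Opposite : Fin (suc (suc n)) → Fin (suc (suc n)) → Set where
    left  : Opposite Fin.zero last
    right : Opposite last Fin.zero

  opposite-distance : ∀ {x y} → Opposite x y → ∣ toℕ y - toℕ x ∣ ≡ suc n
  opposite-distance left  = trans (∣-∣-identityʳ (toℕ last)) toℕ-last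
  opposite-distance right = toℕ-last

  opposite-unique : ∀ {x y z} → Opposite x y → Opposite x z → y ≡ z
  opposite-unique left  left  = refl
  opposite-unique right right = refl

  opposite≢ : ∀ {x y} → Opposite x y → Empty List⁺.[ x ] y
  opposite≢ left  (here ())
  opposite≢ right (here ())

  opposite-farthest : ∀ {x y} → Opposite x y → ∀ z → ∣ toℕ z - toℕ x ∣ ≡ suc n → z ≡ y
  opposite-farthest left  z eq = toℕ-injective (trans (sym (∣-∣-identityʳ (toℕ z))) (trans eq (sym toℕ-last)))
  opposite-farthest right Fin.zero    eq = refl
  opposite-farthest right (Fin.suc z) eq = contradiction
    (begin-strict
      ∣ toℕ z - toℕ (fromℕ n) ∣   ≤⟨ ∣m-n∣≤m⊔n (toℕ z) (toℕ (fromℕ n)) ⟩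
      toℕ z ⊔ toℕ (fromℕ n)       ≤⟨ ⊔-lub (≤-pred (toℕ<n z)) (≤-reflexive (toℕ-fromℕ n)) ⟩
      n                           <⟨ ≤-refl ⟩
      suc n                       ∎) (<-irrefl eq)
    where open ≤-Reasoning

  basic⇒opposite : ∀ {x y z} → Opposite x y → BasicRule List⁺.[ x ] z → Opposite x z
  basic⇒opposite {x} {y} {z} opp (_ , farthest) = subst (Opposite x) (sym (opposite-farthest opp z
    (≤-antisym (≤-trans (∣m-n∣≤m⊔n (toℕ z) (toℕ x)) (⊔-lub (toℕ≤ z) (toℕ≤ x)))
               (≤-trans (≤-reflexive (sym (opposite-distance opp))) (farthest y (opposite≢ opp)))))) opp

  opposite⇒basic : ∀ {x y} → Opposite x y → BasicRule List⁺.[ x ] y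
  opposite⇒basic {x} opp = opposite≢ opp , λ z _ →
    ≤-trans (∣m-n∣≤m⊔n (toℕ z) (toℕ x)) (≤-trans (⊔-lub (toℕ≤ z) (toℕ≤ x)) (≤-reflexive (sym (opposite-distance opp))))

  -- With one person seated the empty places reach an end of the row and form no `Gap`, which needs
  -- occupied places on both sides; the run is therefore given directly.
  opposite-run : ∀ {x y} → Opposite x y → ∃₂ (RunOf List⁺.[ x ] y)
  opposite-run left = Fin.suc Fin.zero , last ,
    ((s≤s z≤n , λ { z 1≤z _ (here refl) → contradiction 1≤z λ () }) ,
     λ a b a≤1 last≤b (_ , free) →
       toℕ-injective (≤-antisym a≤1 (n≢0⇒n>0 λ a≡0 → free Fin.zero (≤-reflexive a≡0) z≤n (here refl))) ,
       toℕ-injective (≤-antisym (≤-trans (toℕ≤ b) (≤-reflexive (sym toℕ-last))) last≤b)) ,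
    s≤s z≤n , ≤-refl
  opposite-run right = Fin.zero , inject₁ (fromℕ n) ,
    ((z≤n , λ { z _ z≤ (here refl) → 1+n≰n (≤-trans (≤-reflexive (sym toℕ-last)) (≤-trans z≤ (≤-reflexive inject-n))) }) ,
     λ a b a≤0 n≤b (_ , free) →
       toℕ-injective (n≤0⇒n≡0 a≤0) ,
       toℕ-injective (≤-antisym (≤-trans (≤-pred (≰⇒> λ last≤b → free last (≤-trans a≤0 z≤n)
         (≤-trans (≤-reflexive toℕ-last) last≤b) (here refl))) (≤-reflexive (sym inject-n))) n≤b)) ,
    z≤n , z≤n
    where
    inject-n : toℕ (inject₁ (fromℕ n)) ≡ n
    inject-n = trans (toℕ-inject₁ (fromℕ n)) (toℕ-fromℕ n)

  opposite⇒modified : ∀ {x y} → Opposite x y → ModifiedRule List⁺.[ x ] y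
  opposite⇒modified {x} {y} opp = let a , b , run = opposite-run opp in
    opposite⇒basic opp , a , b , run , λ z basic a′ b′ run′ → longer run (opposite-unique opp (basic⇒opposite opp basic)) run′
    where
    longer : ∀ {a b a′ b′ z} → RunOf List⁺.[ x ] y a b → y ≡ z → RunOf List⁺.[ x ] z a′ b′ → blockLength a′ b′ ≤ blockLength a b
    longer run refl run′ with runOf-unique List⁺.[ x ] run run′
    ... | refl , refl = ≤-refl

  opposite-gaps : ∀ {x y} → Opposite x y → Gaps (y ∷⁺ List⁺.[ x ]) (gap 0 n ∷ [])
  opposite-gaps {x} {y} opp = record
    { ends     = taken-ends opp ∷ []
    ; free     = (λ inside → avoids opp inside) ∷ []
    ; cover    = λ {z} z∉ → here (n≢0⇒n>0 (λ z≡0 → z∉ (at-start opp z≡0)) ,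
                   ≤∧≢⇒< (toℕ≤ z) (λ z≡ → z∉ (at-end opp z≡)))
    ; disjoint = [] ∷ []
    }
    where
    Row : ∀ {x y} → Opposite x y → Occupied (suc (suc n))
    Row {x} {y} _ = y ∷⁺ List⁺.[ x ]
    taken-ends : ∀ {x y} (o : Opposite x y) → Taken (Row o) 0 × Taken (Row o) (suc n)
    taken-ends left  = (Fin.zero , there (here refl) , refl) , (last , here refl , toℕ-last)
    taken-ends right = (Fin.zero , here refl , refl) , (last , there (here refl) , toℕ-last)
    avoids : ∀ {x y z} (o : Opposite x y) → Inside (toℕ z) (gap 0 n) → Empty (Row o) z
    avoids left  (_ , z<) (here refl)         = <-irrefl toℕ-last z<
    avoids left  (() , _) (there (here refl))
    avoids right (() , _) (here refl)
    avoids right (_ , z<) (there (here refl)) = <-irrefl toℕ-last z<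
    at-start : ∀ {x y z} (o : Opposite x y) → toℕ z ≡ 0 → z ∈ toList (Row o)
    at-start left  z≡0 = there (here (toℕ-injective z≡0))
    at-start right z≡0 = here (toℕ-injective z≡0)
    at-end : ∀ {x y z} (o : Opposite x y) → toℕ z ≡ suc n → z ∈ toList (Row o)
    at-end left  z≡ = here (toℕ-injective (trans z≡ (sym toℕ-last)))
    at-end right z≡ = there (here (toℕ-injective (trans z≡ (sym toℕ-last))))

  leftmost-opposite : ∀ {x} → Leftmost x → Opposite x last
  leftmost-opposite x≡0 = subst (λ x → Opposite x last) (sym (toℕ-injective x≡0)) left

  end-opposite : ∀ {x} → Leftmost x ⊎ Rightmost x → ∃ (Opposite x)
  end-opposite (inj₁ x≡0) = last , leftmost-opposite x≡0
  end-opposite (inj₂ x≡)  = Fin.zero , subst (λ x → Opposite x Fin.zero)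
    (toℕ-injective (trans toℕ-last (sym (suc-injective x≡)))) right

  continuations-end : ∀ {x} → Leftmost x ⊎ Rightmost x →
                      continuations List⁺.[ x ] (suc n) ≡ weight (suc n) (gapCount n)
  continuations-end {x} end = begin
    continuations List⁺.[ x ] (suc n)
      ≡⟨ continuations-suc List⁺.[ x ] n _ (λ (basic , _) → trans
           -- Only `n` places are left, but n + 1 factors are taken to match the product over the
           -- distances 1 to n + 1. The last factor is 1, since no gap has a middle place at
           -- distance n + 1.
           (continuations-weight (suc n) n (opposite-gaps (basic⇒opposite opp basic)) (+-identityʳ n) (n≤1+n n))
           (weight-cong (suc n) (λ r → +-identityʳ (gapCount n r)))) ⟩
    count (modifiedRule? List⁺.[ x ]) (allFin _) * weight (suc n) (gapCount n)
      ≡⟨ cong (_* weight (suc n) (gapCount n)) (count-single (modifiedRule? List⁺.[ x ])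
           (λ (basic , _) → opposite-unique (basic⇒opposite opp basic) opp)
           (opposite⇒modified opp) (allFin⁺ _) (∈-allFin (proj₁ (end-opposite end)))) ⟩
    1 * weight (suc n) (gapCount n)
      ≡⟨ *-identityˡ _ ⟩
    weight (suc n) (gapCount n) ∎
    where
    open ≡-Reasoning
    opp = proj₂ (end-opposite end)

  -- The 2 comes from the first person's two ends, which differ in a row of at least two places;
  -- both lead to the same number of continuations.
  A095240-weight : A095240 (suc (suc n)) ≡ 2 * weight (suc n) (gapCount n)
  A095240-weight = trans
    (count-cartesianProductWith end? (λ x → obeys? modifiedRule? List⁺.[ x ]) modifiedFilling?
      (λ p → p) _,_ (sequences _ (suc n)) _ continuations-end (allFin _))
    (cong (_* weight (suc n) (gapCount n)) (trans
      (count-⊎ end? (λ x → toℕ x ≟ 0) (λ x → suc (toℕ x) ≟ suc (suc n)) (λ p → p) inj₁ inj₂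
        (λ x≡0 x≡ → 1+n≢0 (trans (sym (suc-injective x≡)) x≡0)) (allFin _))
      (cong₂ _+_
        (count-single (λ x → toℕ x ≟ 0) {Fin.zero} toℕ-injective refl (allFin⁺ (suc (suc n))) (∈-allFin _))
        (count-single (λ x → suc (toℕ x) ≟ suc (suc n)) {last}
          (λ x≡ → toℕ-injective (trans (suc-injective x≡) (sym toℕ-last))) (cong suc toℕ-last) (allFin⁺ _) (∈-allFin _)))))
    where
    end? : Decidable (λ x → Leftmost x ⊎ Rightmost x)
    end? x = (toℕ x ≟ 0) ⊎-dec (suc (toℕ x) ≟ suc (suc n))

  d-gapCount : (σ : Vec (Fin (suc (suc n))) (suc (suc n))) → BasicFilling σ → ∀ i →
               d σ (suc i) ≡ gapCount n (suc (i + i))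
  d-gapCount (x Vec.∷ y Vec.∷ ys) (x≡0 , y-basic , ys-basic) i = begin
    count (neighboursAt? (List⁺.[ x ] ∷ later) (suc i)) (pairs (suc (suc n)))
      ≡⟨ count-cong (neighboursAt? (List⁺.[ x ] ∷ later) (suc i)) (neighboursAt? later (suc i))
           (λ { (eq , there any) → eq , any
              -- While only the leftmost place is occupied, the distance of a place is its own
              -- number counted from 0, so neighbours have different distances and the first state
              -- contributes no pair.
              ; (eq , here ((_ , du) , (_ , dv))) → contradiction
                  (trans eq (trans (sym (from-x dv)) (from-x du))) 1+n≢n })
           (λ (eq , any) → eq , there any) (pairs _) ⟩
    count (neighboursAt? later (suc i)) (pairs (suc (suc n)))
      ≡⟨ count-twins (opposite-gaps (basic⇒opposite (leftmost-opposite x≡0) y-basic)) (+-identityʳ n) ys ys-basic i ⟩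
    gapCount n (suc (i + i)) + 0
      ≡⟨ +-identityʳ _ ⟩
    gapCount n (suc (i + i)) ∎
    where
    open ≡-Reasoning
    later = states (y ∷⁺ List⁺.[ x ]) ys
    from-x : ∀ {z k} → ∣ toℕ z - toℕ x ∣ ≡ k → k ≡ toℕ z
    from-x {z} eq = trans (sym eq) (trans (cong (λ l → ∣ toℕ z - l ∣) x≡0) (∣-∣-identityʳ (toℕ z)))

  b-gapCount : (σ : Vec (Fin (suc (suc n))) (suc (suc n))) → BasicFilling σ → ∀ i →
               b σ (suc i) ≡ 𝟙 (n ≟ i) + (gapCount n (suc (i + i)) + gapCount n (i + i))
  b-gapCount (x Vec.∷ y Vec.∷ ys) (x≡0 , y-basic , ys-basic) i = begin
    count (_≟ suc i) (∣ toℕ y - toℕ x ∣ ∷ later)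
      ≡⟨ count-∷ (_≟ suc i) ∣ toℕ y - toℕ x ∣ later ⟩
    𝟙 (∣ toℕ y - toℕ x ∣ ≟ suc i) + count (_≟ suc i) later
      ≡⟨ cong₂ _+_ (trans (cong (λ l → 𝟙 (l ≟ suc i)) (opposite-distance opp)) (𝟙-⇔ (suc n ≟ suc i) (n ≟ i) suc-injective (cong suc)))
           (count-chosenDistances (opposite-gaps opp) (+-identityʳ n) ys ys-basic i) ⟩
    𝟙 (n ≟ i) + ((gapCount n (suc (i + i)) + 0) + (gapCount n (i + i) + 0))
      ≡⟨ cong (𝟙 (n ≟ i) +_) (cong₂ _+_ (+-identityʳ (gapCount n (suc (i + i)))) (+-identityʳ (gapCount n (i + i)))) ⟩
    𝟙 (n ≟ i) + (gapCount n (suc (i + i)) + gapCount n (i + i)) ∎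
    where
    open ≡-Reasoning
    later = chosenDistances (y ∷⁺ List⁺.[ x ]) ys
    opp = basic⇒opposite (leftmost-opposite x≡0) y-basic

  -- At the distance n + 1 of the second person nobody else is counted, so
  -- that this person contributes the factor 1! = 0!.
  [b∸d]! : (σ : Vec (Fin (suc (suc n))) (suc (suc n))) → BasicFilling σ → ∀ i →
           (b σ (suc i) ∸ d σ (suc i)) ! ≡ gapCount n (i + i) !
  [b∸d]! σ basic i = begin
    (b σ (suc i) ∸ d σ (suc i)) !               ≡⟨ cong _! (cong₂ _∸_ (b-gapCount σ basic i) (d-gapCount σ basic i)) ⟩
    (𝟙 (n ≟ i) + (q₁ + q₀) ∸ q₁) !              ≡⟨ cong (λ l → (l ∸ q₁) !) (solve 3 (λ x y z → x :+ (y :+ z) := y :+ (x :+ z)) refl (𝟙 (n ≟ i)) q₁ q₀) ⟩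
    (q₁ + (𝟙 (n ≟ i) + q₀) ∸ q₁) !              ≡⟨ cong _! (m+n∸m≡n q₁ (𝟙 (n ≟ i) + q₀)) ⟩
    (𝟙 (n ≟ i) + q₀) !                          ≡⟨ go (n ≟ i) ⟩
    q₀ !                                        ∎
    where
    open ≡-Reasoning
    open +-*-Solver
    q₀ = gapCount n (i + i)
    q₁ = gapCount n (suc (i + i))
    go : Dec (n ≡ i) → (𝟙 (n ≟ i) + q₀) ! ≡ q₀ !
    go (no n≢i)   = cong (λ l → (l + q₀) !) (𝟙-no (n ≟ i) n≢i)
    go (yes refl) = trans (cong₂ (λ l q → (l + q) !) (𝟙-yes (n ≟ n) refl) q₀≡0)
                          (cong _! (sym q₀≡0))
      where q₀≡0 : gapCount n (n + n) ≡ 0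
            q₀≡0 = pieces-large n (m≤m+n n n)

mainTheorem6 : (n : ℕ) → 2 ≤ n → (σ : Vec (Fin n) n) → BasicFilling σ →
    A095240 n ≡ 2 * ∏[1≤j< n ] (λ j → 2 ^ d σ j * (d σ j) ! * (b σ j ∸ d σ j) !)
mainTheorem6 (suc (suc n)) (s≤s (s≤s z≤n)) σ basic = trans (A095240-weight {n}) (cong (2 *_)
  (product-applyUpTo-cong (suc n) (λ i _ → sym (cong₂ _*_
    (cong (λ q → 2 ^ q * q !) (d-gapCount σ basic i)) ([b∸d]! σ basic i)))))
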